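{- Let $q$ be a prime power. Pick positive integers $r$ and $n$ with $r\equiv n \pmod{q+1}$, distinct elements $u,v\in\mu_{q+1}$, and elements $a,b\in\mathbb{F}_{q^2}^*$, and write \[ B(X) := a(X+u)^n + b(X+v)^n \in \mathbb{F}_{q^2}[X]. \] Then the polynomial $f(X):=X^r B(X^{q-1})$ permutes $\mathbb{F}_{q^2}$ (i.e., the map $c\mapsto f(c)$ is a bijection $\mathbb{F}_{q^2}\to\mathbb{F}_{q^2}$) if and only if $(b/a)^{q-1}\neq (v/u)^n$ and $\gcd(rn,q-1)=1$.
   Context: $\mu_{q+1}$ denotes the set of $(q+1)$-th roots of unity in $\mathbb{F}_{q^2}^*$. -}

module Defs where

open import Level using (0ℓ)
open import Data.Nat using (ℕ; zero; suc)
open import Data.Nat.Primality using (Prime)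
open import Data.Fin using (Fin)
open import Data.Product using (∃₂; _×_)
open import Relation.Binary.PropositionalEquality using (_≡_; _≢_)
open import Algebra.Structures using (IsCommutativeRing)
open import Function.Bundles using (_↔_)

IsPrimePower : ℕ → Set
IsPrimePower q = ∃₂ λ p k → Prime p × (1 Data.Nat.≤ k) × q ≡ p Data.Nat.^ k

record FiniteField (m : ℕ) : Set₁ where
  infixl 7 _*_
  infixl 6 _+_
  field
    Carrier : Set
    _+_ _*_ : Carrier → Carrier → Carrier
    -_ : Carrier → Carrier
    0# 1# : Carrier
    _⁻¹ : Carrier → Carrier
    isCommutativeRing : IsCommutativeRing _≡_ _+_ _*_ -_ 0# 1#
    0≢1 : 0# ≢ 1#
    inverseʳ : ∀ x → x ≢ 0# → x * (x ⁻¹) ≡ 1#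
    enumeration : Fin m ↔ Carrier

  infixr 8 _^_
  _^_ : Carrier → ℕ → Carrier
  x ^ zero = 1#
  x ^ suc k = x * (x ^ k)

  _/_ : Carrier → Carrier → Carrier
  x / y = x * (y ⁻¹)

  μ : ℕ → Carrier → Set
  μ k x = x ^ k ≡ 1#

{-# OPTIONS --safe #-}
-- Put q = e + 1, φ(x) = x^q, N(x) = x^(q+1) and, for c ∈ μ_{q+1}, L_c(x) = x^q + c x. The image of L_c lies
-- in the F_q-line W(c) = {w : φ(w) c = w}, and x ↦ (L_u(x), L_v(x)) identifies F_{q²} with W(u) × W(v). Since
-- r ≡ n mod q + 1, there is k with f(x) = N(x)^k (a L_u(x)^n + b L_v(x)^n). The bracket lies in
-- a W(uⁿ) + b W(vⁿ), and this sum is direct iff (b/a)^(q−1) ≠ (v/u)^n. So f acts on the pair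
-- (L_u(x), L_v(x)) by n-th powers, which are injective up to F_q-scaling iff gcd(n, q−1) = 1, while on
-- the F_q-line through x it acts by λ ↦ λ^r, which is injective iff gcd(r, q−1) = 1.

module Submission where

open import Defs
open import Level using (0ℓ)
open import Algebra.Bundles using (CommutativeMonoid; CommutativeRing)
import Algebra.Properties.CommutativeMonoid.Sum as MonoidSum
import Algebra.Properties.CommutativeSemiring.Binomial as Binomial
import Algebra.Properties.CommutativeSemiring.Exp as CommutativeExp
import Algebra.Properties.Group as GroupProperties
import Algebra.Properties.Semiring.Exp as Exp
import Algebra.Properties.Semiring.Mult as Mult
import Algebra.Solver.Ring.NaturalCoefficients.Default as Solver
open import Data.Fin as Fin using (Fin; zero; suc; toℕ; fromℕ; punchIn; inject≤)
import Data.Fin.Properties as Fin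
open import Data.Nat using (ℕ; zero; suc; _≤_; _<_; s≤s; z≤n; nonTrivial⇒n>1; _%_; _∸_) renaming (_/_ to _/ℕ_; _+_ to _+ℕ_; _*_ to _*ℕ_; _^_ to _^ℕ_)
import Data.Nat.Properties as ℕ
open import Data.Nat.Combinatorics using (_C_; nCn≡1; nC1≡n; k>n⇒nCk≡0; nCk+nC[k+1]≡[n+1]C[k+1])
open import Data.Nat.Coprimality using (Coprime; coprime-Bézout; coprime-divisor; coprime⇒gcd≡1; gcd≡1⇒coprime)
open import Data.Nat.Divisibility using (_∣_; divides; ∣⇒≤; ∣1⇒≡1; ∣m⇒∣m*n; ∣-trans)
open import Data.Nat.DivMod using (m≡m%n+[m/n]*n)
open import Data.Nat.GCD using (gcd; gcd[m,n]∣m; gcd[m,n]∣n; gcd-greatest; module Bézout)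
open import Data.Nat.Primality using (Prime; euclidsLemma; prime⇒nonTrivial; prime⇒nonZero; ¬prime[0])
import Data.Nat.Solver
open import Data.Product using (∃; _×_; _,_)
open import Data.Sum using (inj₁; inj₂)
open import Data.Vec.Functional using (Vector; replicate)
open import Function.Base using (_∘_)
open import Function.Bundles using (Injection; Inverse; _↔_; _⇔_; mk↔ₛ′; mk⇔)
open import Function.Construct.Composition using (_↔-∘_)
open import Function.Construct.Symmetry using (↔-sym)
open import Function.Definitions using (Bijective; Injective)
open import Function.Properties.Inverse using (↔⇒↣)
open import Relation.Binary.Definitions using (DecidableEquality)
open import Relation.Binary.PropositionalEquality
open import Relation.Nullary using (Dec; yes; no; contradiction)
open import Relation.Nullary.Decidable using (via-injection; decidable-stable; ¬?)
open ≡-Reasoning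

-- Directness of the sum comes down to comparing two parameters: aW(uⁿ) = W(uⁿ a^(1-q)) and bW(vⁿ) =
-- W(vⁿ b^(1-q)), and a nonzero w common to W(c) and W(c′) forces c = w/φ(w) = c′. Clearing
-- denominators turns this comparison into `d₁` against `d₂`. The obstacle is the factor N(x)^k,
-- which depends on x, so that f(x) = f(y) is not the same as equality of the brackets. For
-- sufficiency it is harmless, since it multiplies both components alike: if L_u(y) = l L_u(x) and
-- L_v(y) = l′ L_v(x), then lⁿ and l′ⁿ both equal (N(x)/N(y))^k. For necessity it has to be absorbed
-- by rescaling y with an element of F_q whose r-th power is prescribed, which requires gcd(r, q-1)
-- = 1. This dictates the order of the necessity proof: the condition on r comes from the line
-- through 1 alone, the condition on n uses it, and directness comes last because it extracts an
-- n-th root in F_q.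

-- Finite sums in a commutative monoid

module _ (M : CommutativeMonoid 0ℓ 0ℓ) where
  open CommutativeMonoid M using (_≈_; ε; ∙-congˡ; identityʳ; reflexive) renaming (trans to ≈-trans; Carrier to A)
  open MonoidSum M using (sum; sum-remove; sum-cong-≋; sum-replicate-zero; sum-permute)

  sum-singleton : ∀ {n} (t : Vector A n) i → (∀ j → j ≢ i → t j ≈ ε) → sum t ≈ t i
  sum-singleton {suc n} t i t≈ε =
    ≈-trans (sum-remove {i = i} t)
      (≈-trans (∙-congˡ (≈-trans (sum-cong-≋ λ j → t≈ε (punchIn i j) (Fin.punchInᵢ≢i i j))
                                 (sum-replicate-zero n)))
               (identityʳ (t i)))

  -- Conjugating `σ` by the enumeration gives a permutation of the indices. The uses are
  -- multiplication by a nonzero element and translation by 1.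
  sum-reindex : ∀ {n} {B : Set} (e : Fin n ↔ B) (h : B → A) (σ : B ↔ B) →
                sum (h ∘ Inverse.to e) ≈ sum (h ∘ Inverse.to σ ∘ Inverse.to e)
  sum-reindex e h σ =
    ≈-trans (sum-permute (h ∘ Inverse.to e) (↔-sym e ↔-∘ (σ ↔-∘ e)))
      (sum-cong-≋ λ i → reflexive (cong h (Inverse.strictlyInverseˡ e (Inverse.to σ (Inverse.to e i)))))

-- Binomial coefficients modulo a prime

absorption : ∀ n k → suc k *ℕ (suc n C suc k) ≡ suc n *ℕ (n C k)
absorption n zero =
  trans (ℕ.*-identityˡ (suc n C 1)) (trans (nC1≡n (suc n)) (sym (ℕ.*-identityʳ (suc n))))
absorption zero (suc k) =
  trans (cong (suc (suc k) *ℕ_) (k>n⇒nCk≡0 {1} {suc (suc k)} (s≤s (s≤s z≤n))))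
    (trans (ℕ.*-zeroʳ (suc (suc k))) (sym (trans (ℕ.*-identityˡ _) (k>n⇒nCk≡0 {0} {suc k} (s≤s z≤n)))))
absorption (suc n) (suc k) = begin
  suc (suc k) *ℕ (suc (suc n) C suc (suc k))
    ≡⟨ cong (suc (suc k) *ℕ_) (nCk+nC[k+1]≡[n+1]C[k+1] (suc n) (suc k)) ⟨
  suc (suc k) *ℕ (x +ℕ y)
    ≡⟨ solve 3 (λ k x y → (con 2 :+ k) :* (x :+ y) := x :+ ((con 1 :+ k) :* x :+ (con 2 :+ k) :* y)) refl k x y ⟩
  x +ℕ (suc k *ℕ x +ℕ suc (suc k) *ℕ y)
    ≡⟨ cong (x +ℕ_) (cong₂ _+ℕ_ (absorption n k) (absorption n (suc k))) ⟩
  x +ℕ (suc n *ℕ (n C k) +ℕ suc n *ℕ (n C suc k))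
    ≡⟨ cong (x +ℕ_) (ℕ.*-distribˡ-+ (suc n) (n C k) (n C suc k)) ⟨
  x +ℕ suc n *ℕ (n C k +ℕ n C suc k)
    ≡⟨ cong (λ z → x +ℕ suc n *ℕ z) (nCk+nC[k+1]≡[n+1]C[k+1] n k) ⟩
  suc (suc n) *ℕ x ∎
  where
  open Data.Nat.Solver.+-*-Solver
  x = suc n C suc k
  y = suc n C suc (suc k)

-- By `absorption` the prime divides the product of `suc k` and the coefficient, and it is too large
-- to divide `suc k`.
prime∣binomial : ∀ {p} k → Prime (suc p) → suc k < suc p → suc p ∣ (suc p C suc k)
prime∣binomial {p} k pr k<p
  with euclidsLemma (suc k) (suc p C suc k) pr
         (divides (p C k) (trans (absorption p k) (ℕ.*-comm (suc p) (p C k))))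
... | inj₁ p∣k = contradiction (∣⇒≤ p∣k) (ℕ.<⇒≱ k<p)
... | inj₂ p∣C = p∣C

-- Arithmetic in a finite field

module FiniteFieldProperties {m} (F : FiniteField m) where
  open FiniteField F public

  commutativeRing : CommutativeRing 0ℓ 0ℓ
  commutativeRing = record { isCommutativeRing = isCommutativeRing }

  open CommutativeRing commutativeRing public
    using ( +-assoc; +-comm; +-identityˡ; +-identityʳ; *-assoc; *-comm; *-identityˡ; *-identityʳ
          ; zeroˡ; zeroʳ; distribˡ; distribʳ; _-_; -‿inverseʳ
          ; semiring; commutativeSemiring; +-group; +-commutativeMonoid; *-commutativeMonoid)
  open GroupProperties +-group public using ()
    renaming ( ∙-cancelˡ to +-cancelˡ; ∙-cancelʳ to +-cancelʳ; x∙y⁻¹≈ε⇒x≈y to x-y≡0⇒x≡y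
             ; inverseˡ-unique to x+y≡0⇒x≡-y)
  open Solver commutativeSemiring public using (solve; _:=_; _:+_; _:*_; con)
  open Mult semiring using (×1-homo-*; ×-assoc-*; ×-homo-1) renaming (_×_ to _ℕ×_)

  x-y+y≡x : ∀ x y → x - y + y ≡ x
  x-y+y≡x x y = begin
    x + - y + y     ≡⟨ +-assoc x (- y) y ⟩
    x + (- y + y)   ≡⟨ cong (x +_) (trans (+-comm (- y) y) (-‿inverseʳ y)) ⟩
    x + 0#          ≡⟨ +-identityʳ x ⟩
    x               ∎

  -- Bridge to the power of the standard library, along which its laws are transported by rewriting.
  ^≡ : ∀ x n → x ^ n ≡ Exp._^_ semiring x n
  ^≡ x zero = refl
  ^≡ x (suc n) = cong (x *_) (^≡ x n)

  ^-homo-* : ∀ x j k → x ^ (j +ℕ k) ≡ x ^ j * x ^ k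
  ^-homo-* x j k rewrite ^≡ x (j +ℕ k) | ^≡ x j | ^≡ x k = Exp.^-homo-* semiring x j k

  ^-assocʳ : ∀ x j k → (x ^ j) ^ k ≡ x ^ (j *ℕ k)
  ^-assocʳ x j k rewrite ^≡ (x ^ j) k | ^≡ x j | ^≡ x (j *ℕ k) = Exp.^-assocʳ semiring x j k

  ^-distrib-* : ∀ x y n → (x * y) ^ n ≡ x ^ n * y ^ n
  ^-distrib-* x y n rewrite ^≡ (x * y) n | ^≡ x n | ^≡ y n = CommutativeExp.^-distrib-* commutativeSemiring x y n

  ^-comm : ∀ x j k → (x ^ j) ^ k ≡ (x ^ k) ^ j
  ^-comm x j k = trans (^-assocʳ x j k) (trans (cong (x ^_) (ℕ.*-comm j k)) (sym (^-assocʳ x k j)))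

  1^ : ∀ n → 1# ^ n ≡ 1#
  1^ zero = refl
  1^ (suc n) = trans (*-identityˡ _) (1^ n)

  0^ : ∀ n → 1 ≤ n → 0# ^ n ≡ 0#
  0^ (suc n) _ = zeroˡ _

  infix 4 _≟_
  _≟_ : DecidableEquality Carrier
  _≟_ = via-injection (↔⇒↣ (↔-sym enumeration)) Fin._≟_

  inverseˡ : ∀ x → x ≢ 0# → x ⁻¹ * x ≡ 1#
  inverseˡ x x≢0 = trans (*-comm _ _) (inverseʳ x x≢0)

  *-cancelˡ : ∀ x {y z} → x ≢ 0# → x * y ≡ x * z → y ≡ z
  *-cancelˡ x {y} {z} x≢0 xy≡xz = begin
    y                ≡⟨ cancel y ⟨
    x ⁻¹ * (x * y)   ≡⟨ cong (x ⁻¹ *_) xy≡xz ⟩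
    x ⁻¹ * (x * z)   ≡⟨ cancel z ⟩
    z                ∎
    where
    cancel : ∀ w → x ⁻¹ * (x * w) ≡ w
    cancel w = trans (sym (*-assoc _ _ _)) (trans (cong (_* w) (inverseˡ x x≢0)) (*-identityˡ w))

  *-cancelʳ : ∀ x {y z} → x ≢ 0# → y * x ≡ z * x → y ≡ z
  *-cancelʳ x x≢0 eq = *-cancelˡ x x≢0 (trans (*-comm _ _) (trans eq (*-comm _ _)))

  *-nonZero : ∀ {x y} → x ≢ 0# → y ≢ 0# → x * y ≢ 0#
  *-nonZero x≢0 y≢0 xy≡0 = y≢0 (*-cancelˡ _ x≢0 (trans xy≡0 (sym (zeroʳ _))))

  ^-nonZero : ∀ {x} n → x ≢ 0# → x ^ n ≢ 0#
  ^-nonZero zero x≢0 = 0≢1 ∘ sym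
  ^-nonZero (suc n) x≢0 = *-nonZero x≢0 (^-nonZero n x≢0)

  x^n≡0⇒x≡0 : ∀ {x} n → x ^ n ≡ 0# → x ≡ 0#
  x^n≡0⇒x≡0 {x} n eq = decidable-stable (x ≟ 0#) λ x≢0 → ^-nonZero n x≢0 eq

  x^n≡1⇒x≢0 : ∀ {x} n → x ^ suc n ≡ 1# → x ≢ 0#
  x^n≡1⇒x≢0 n eq refl = 0≢1 (trans (sym (zeroˡ _)) eq)

  private
    elem : Fin m → Carrier
    elem = Inverse.to enumeration

  -- Fermat's theorem and the characteristic

  module _ (x : Carrier) (x≢0 : x ≢ 0#) where
    open MonoidSum *-commutativeMonoid
      renaming (sum to product; sum-replicate to product-replicate; ∑-distrib-+ to ∏-distrib-*)

    -- Put h(y) = y for y ≠ 0 and h(0) = 1, and g(y) = 1 for y ≠ 0 and g(0) = x. Then g(y) h(xy) = x h(y),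
    -- and as y ↦ xy permutes F, taking the product over all y gives x H = xᵐ H with H = ∏ h ≠ 0.
    private
      orElse : Carrier → Carrier → Carrier → Carrier
      orElse z w y with y ≟ 0#
      ... | yes _ = z
      ... | no _ = w

      orElse-≡ : ∀ {z w y} → y ≡ 0# → orElse z w y ≡ z
      orElse-≡ {y = y} y≡0 with y ≟ 0#
      ... | yes _ = refl
      ... | no y≢0 = contradiction y≡0 y≢0

      orElse-≢ : ∀ {z w y} → y ≢ 0# → orElse z w y ≡ w
      orElse-≢ {y = y} y≢0 with y ≟ 0#
      ... | yes y≡0 = contradiction y≡0 y≢0
      ... | no _ = refl

      g h : Carrier → Carrier
      g y = orElse x 1# y
      h y = orElse 1# y y

      scale : ∀ y → g y * h (x * y) ≡ x * h y
      scale y = case (y ≟ 0#)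
        where
        case : Dec (y ≡ 0#) → g y * h (x * y) ≡ x * h y
        case (yes y≡0) = cong₂ _*_ (orElse-≡ y≡0)
          (trans (orElse-≡ (trans (cong (x *_) y≡0) (zeroʳ x))) (sym (orElse-≡ y≡0)))
        case (no y≢0) = trans (cong₂ _*_ (orElse-≢ y≢0) (orElse-≢ (*-nonZero x≢0 y≢0)))
          (trans (*-identityˡ _) (cong (x *_) (sym (orElse-≢ y≢0))))

      h-nonZero : ∀ y → h y ≢ 0#
      h-nonZero y with y ≟ 0#
      ... | yes _ = 0≢1 ∘ sym
      ... | no y≢0 = y≢0

      product-nonZero : ∀ {k} (t : Vector Carrier k) → (∀ i → t i ≢ 0#) → product t ≢ 0#
      product-nonZero {zero} t t≢0 = 0≢1 ∘ sym
      product-nonZero {suc k} t t≢0 = *-nonZero (t≢0 zero) (product-nonZero (t ∘ suc) (t≢0 ∘ suc))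

      multiplication : Carrier ↔ Carrier
      multiplication = mk↔ₛ′ (x *_) (x ⁻¹ *_)
        (λ y → trans (sym (*-assoc _ _ _)) (trans (cong (_* y) (inverseʳ x x≢0)) (*-identityˡ y)))
        (λ y → trans (sym (*-assoc _ _ _)) (trans (cong (_* y) (inverseˡ x x≢0)) (*-identityˡ y)))

      ∏g≡x : product (g ∘ elem) ≡ x
      ∏g≡x = trans
        (sum-singleton *-commutativeMonoid (g ∘ elem) (Inverse.from enumeration 0#)
          λ j j≢ → orElse-≢ λ ej≡0 → j≢ (trans (sym (Inverse.strictlyInverseʳ enumeration j)) (cong (Inverse.from enumeration) ej≡0)))
        (orElse-≡ (Inverse.strictlyInverseˡ enumeration 0#))

      H : Carrier
      H = product (h ∘ elem)

    x≢0⇒x^m≡x : x ^ m ≡ x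
    x≢0⇒x^m≡x = *-cancelʳ H (product-nonZero (h ∘ elem) (h-nonZero ∘ elem)) (begin
      x ^ m * H ≡⟨ cong (_* H) (trans (^≡ x m) (sym (product-replicate m))) ⟩
      product (replicate m x) * H ≡⟨ ∏-distrib-* (replicate m x) (h ∘ elem) ⟨
      product (λ i → x * h (elem i)) ≡⟨ sum-cong-≋ (λ i → sym (scale (elem i))) ⟩
      product (λ i → g (elem i) * h (x * elem i)) ≡⟨ ∏-distrib-* (g ∘ elem) (λ i → h (x * elem i)) ⟩
      product (g ∘ elem) * product (λ i → h (x * elem i))
        ≡⟨ cong₂ _*_ ∏g≡x (sym (sum-reindex *-commutativeMonoid enumeration h multiplication)) ⟩
      x * H ∎)

  x^m≡x : 1 ≤ m → ∀ x → x ^ m ≡ x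
  x^m≡x 1≤m x with x ≟ 0#
  ... | yes refl = 0^ m 1≤m
  ... | no x≢0 = x≢0⇒x^m≡x x x≢0

  -- The translation by 1 permutes F, so the sum S of all elements satisfies S = S + m · 1.
  m×1≡0 : m ℕ× 1# ≡ 0#
  m×1≡0 = +-cancelˡ S _ _ (begin
    S + m ℕ× 1# ≡⟨ cong (S +_) (sum-replicate m) ⟨
    S + sum (replicate m 1#) ≡⟨ ∑-distrib-+ elem (replicate m 1#) ⟨
    sum (λ i → elem i + 1#) ≡⟨ sum-reindex +-commutativeMonoid enumeration (λ y → y) translation ⟨
    S ≡⟨ +-identityʳ S ⟨
    S + 0# ∎)
    where
    open MonoidSum +-commutativeMonoid
    S = sum elem
    translation : Carrier ↔ Carrier
    translation = mk↔ₛ′ (_+ 1#) (_+ (- 1#))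
      (λ y → trans (+-assoc _ _ _) (trans (cong (y +_) (trans (+-comm _ _) (-‿inverseʳ 1#))) (+-identityʳ y)))
      (λ y → trans (+-assoc _ _ _) (trans (cong (y +_) (-‿inverseʳ 1#)) (+-identityʳ y)))

  -- The map j ↦ j · 1 is multiplicative, so m · 1 = 0 is the k-th power of p · 1, and a field has
  -- no nilpotents.
  characteristic : ∀ {p} k → m ≡ p ^ℕ k → p ℕ× 1# ≡ 0#
  characteristic {p} k refl = x^n≡0⇒x≡0 k (trans (sym (×1-homo-^ k)) m×1≡0)
    where
    ×1-homo-^ : ∀ k → (p ^ℕ k) ℕ× 1# ≡ (p ℕ× 1#) ^ k
    ×1-homo-^ zero = ×-homo-1 1#
    ×1-homo-^ (suc k) = trans (×1-homo-* p (p ^ℕ k)) (cong ((p ℕ× 1#) *_) (×1-homo-^ k))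

  -- Additivity of the Frobenius map

  module _ {p} (pr : Prime p) (p×1≡0 : p ℕ× 1# ≡ 0#) where

    ∣⇒×≡0 : ∀ {k} → p ∣ k → ∀ x → k ℕ× x ≡ 0#
    ∣⇒×≡0 (divides j refl) x = begin
      (j *ℕ p) ℕ× x ≡⟨ cong ((j *ℕ p) ℕ×_) (*-identityˡ x) ⟨
      (j *ℕ p) ℕ× (1# * x) ≡⟨ ×-assoc-* (j *ℕ p) 1# x ⟨
      (j *ℕ p) ℕ× 1# * x ≡⟨ cong (_* x) (×1-homo-* j p) ⟩
      j ℕ× 1# * p ℕ× 1# * x ≡⟨ cong (λ z → j ℕ× 1# * z * x) p×1≡0 ⟩
      j ℕ× 1# * 0# * x ≡⟨ cong (_* x) (zeroʳ _) ⟩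
      0# * x ≡⟨ zeroˡ x ⟩
      0# ∎

    frobenius-+ : ∀ x y → (x + y) ^ p ≡ x ^ p + y ^ p
    frobenius-+ = go p pr ∣⇒×≡0
      where
      open MonoidSum +-commutativeMonoid
      -- `p` is a module parameter; rebinding it allows matching on `suc p`, which the indices of
      -- the binomial sum require.
      go : ∀ p → Prime p → (∀ {k} → p ∣ k → ∀ x → k ℕ× x ≡ 0#) → ∀ x y → (x + y) ^ p ≡ x ^ p + y ^ p
      go zero pr _ = contradiction pr ¬prime[0]
      go (suc p) pr ∣⇒0 x y = begin
        (x + y) ^ suc p ≡⟨ ^≡ (x + y) (suc p) ⟩
        Exp._^_ semiring (x + y) (suc p) ≡⟨ Binomial.theorem commutativeSemiring (suc p) x y ⟩
        term zero + sum (term ∘ suc) ≡⟨ cong₂ _+_ first middle ⟩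
        y ^ suc p + x ^ suc p ≡⟨ +-comm _ _ ⟩
        x ^ suc p + y ^ suc p ∎
        where
        open import Algebra.Properties.Semiring.Binomial semiring x y using (binomial; binomialTerm)
        term = binomialTerm (suc p)

        first : term zero ≡ y ^ suc p
        first = trans (×-homo-1 _) (trans (*-identityˡ _) (sym (^≡ y (suc p))))

        -- Of the indices `suc j` only `j = p` survives; for every other `j` the coefficient is
        -- divisible by the prime.
        middle : sum (term ∘ suc) ≡ x ^ suc p
        middle = trans
          (sum-singleton +-commutativeMonoid (term ∘ suc) (fromℕ p) λ j j≢p →
             ∣⇒0 (prime∣binomial (toℕ j) pr
                   (s≤s (ℕ.≤∧≢⇒< (ℕ.≤-pred (Fin.toℕ<n j)) λ eq → j≢p (Fin.toℕ-injective (trans eq (sym (Fin.toℕ-fromℕ p)))))))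
                 (binomial (suc p) (suc j)))
          (begin
            (suc p C suc (toℕ (fromℕ p))) ℕ× binomial (suc p) (suc (fromℕ p))
              ≡⟨ cong (λ j → (suc p C suc j) ℕ× (Exp._^_ semiring x (suc j) * Exp._^_ semiring y (p ∸ j))) (Fin.toℕ-fromℕ p) ⟩
            (suc p C suc p) ℕ× (Exp._^_ semiring x (suc p) * Exp._^_ semiring y (p ∸ p))
              ≡⟨ cong₂ (λ c j → c ℕ× (Exp._^_ semiring x (suc p) * Exp._^_ semiring y j)) (nCn≡1 (suc p)) (ℕ.n∸n≡0 p) ⟩
            1 ℕ× (Exp._^_ semiring x (suc p) * 1#)
              ≡⟨ trans (×-homo-1 _) (*-identityʳ _) ⟩
            Exp._^_ semiring x (suc p) ≡⟨ ^≡ x (suc p) ⟨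
            x ^ suc p ∎)

    frobenius^-+ : ∀ k x y → (x + y) ^ (p ^ℕ k) ≡ x ^ (p ^ℕ k) + y ^ (p ^ℕ k)
    frobenius^-+ zero x y = trans (*-identityʳ _) (sym (cong₂ _+_ (*-identityʳ x) (*-identityʳ y)))
    frobenius^-+ (suc k) x y = begin
      (x + y) ^ (p *ℕ p ^ℕ k) ≡⟨ ^-assocʳ (x + y) p (p ^ℕ k) ⟨
      ((x + y) ^ p) ^ (p ^ℕ k) ≡⟨ cong (_^ (p ^ℕ k)) (frobenius-+ x y) ⟩
      (x ^ p + y ^ p) ^ (p ^ℕ k) ≡⟨ frobenius^-+ k (x ^ p) (y ^ p) ⟩
      (x ^ p) ^ (p ^ℕ k) + (y ^ p) ^ (p ^ℕ k) ≡⟨ cong₂ _+_ (^-assocʳ x p (p ^ℕ k)) (^-assocʳ y p (p ^ℕ k)) ⟩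
      x ^ (p *ℕ p ^ℕ k) + y ^ (p *ℕ p ^ℕ k) ∎

  -- Polynomial functions and their roots

  -- f is a polynomial function of degree at most d whose coefficient at Xᵈ is c: for every a there is
  -- a quotient g with f(x) − f(a) = (x − a) g(x), here with the subtractions moved to the other side.
  Poly : ℕ → Carrier → (Carrier → Carrier) → Set
  Poly zero c f = ∀ x → f x ≡ c
  Poly (suc d) c f = ∀ a → ∃ λ g → Poly d c g × (∀ x → f x + a * g x ≡ f a + x * g x)

  poly-+ : ∀ d {c c′ f f′} → Poly d c f → Poly d c′ f′ → Poly d (c + c′) (λ x → f x + f′ x)
  poly-+ zero P P′ x = cong₂ _+_ (P x) (P′ x)
  poly-+ (suc d) {f = f} {f′} P P′ a with P a | P′ a
  ... | g , Q , eq | g′ , Q′ , eq′ = (λ x → g x + g′ x) , poly-+ d Q Q′ , λ x → begin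
    f x + f′ x + a * (g x + g′ x)
      ≡⟨ solve 5 (λ x y a z w → x :+ y :+ a :* (z :+ w) := (x :+ a :* z) :+ (y :+ a :* w)) refl (f x) (f′ x) a (g x) (g′ x) ⟩
    (f x + a * g x) + (f′ x + a * g′ x) ≡⟨ cong₂ _+_ (eq x) (eq′ x) ⟩
    (f a + x * g x) + (f′ a + x * g′ x)
      ≡⟨ solve 5 (λ x y a z w → (x :+ a :* z) :+ (y :+ a :* w) := x :+ y :+ a :* (z :+ w)) refl (f a) (f′ a) x (g x) (g′ x) ⟩
    f a + f′ a + x * (g x + g′ x) ∎

  poly-scale : ∀ d b {c f} → Poly d c f → Poly d (b * c) (λ x → b * f x)
  poly-scale zero b P x = cong (b *_) (P x)
  poly-scale (suc d) b {f = f} P a with P a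
  ... | g , Q , eq = (λ x → b * g x) , poly-scale d b Q , λ x → begin
    b * f x + a * (b * g x) ≡⟨ solve 4 (λ b y a z → b :* y :+ a :* (b :* z) := b :* (y :+ a :* z)) refl b (f x) a (g x) ⟩
    b * (f x + a * g x) ≡⟨ cong (b *_) (eq x) ⟩
    b * (f a + x * g x) ≡⟨ solve 4 (λ b y a z → b :* (y :+ a :* z) := b :* y :+ a :* (b :* z)) refl b (f a) x (g x) ⟩
    b * f a + x * (b * g x) ∎

  poly-const : ∀ d c → Poly (suc d) 0# (λ _ → c)
  poly-const zero c a = (λ _ → 0#) , (λ _ → refl) , λ x → cong (c +_) (trans (zeroʳ a) (sym (zeroʳ x)))
  poly-const (suc d) c a = (λ _ → 0#) , poly-const d 0# , λ x → cong (c +_) (trans (zeroʳ a) (sym (zeroʳ x)))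

  poly-raise : ∀ d {c f} → Poly d c f → Poly (suc d) 0# f
  poly-raise zero P a = (λ _ → 0#) , (λ _ → refl) , λ x →
    cong₂ _+_ (trans (P x) (sym (P a))) (trans (zeroʳ a) (sym (zeroʳ x)))
  poly-raise (suc d) P a with P a
  ... | g , Q , eq = g , poly-raise d Q , eq

  -- From x f(x) - a f(a) = (x - a) f(x) + a (f(x) - f(a)) the new quotient is f + a g. The summand
  -- a g has lower degree, so it enters through `poly-raise` and leaves the leading coefficient
  -- alone.
  poly-shift : ∀ d {c f} → Poly d c f → Poly (suc d) c (λ x → x * f x)
  poly-shift zero {c} {f} P a = (λ _ → c) , (λ _ → refl) , λ x → begin
    x * f x + a * c ≡⟨ cong₂ (λ y z → x * y + a * z) (P x) (sym (P a)) ⟩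
    x * c + a * f a ≡⟨ +-comm _ _ ⟩
    a * f a + x * c ∎
  poly-shift (suc d) {c} {f} P a with P a
  ... | g , Q , eq = (λ x → f x + a * g x)
    , subst (λ c → Poly (suc d) c (λ x → f x + a * g x)) (+-identityʳ c) (poly-+ (suc d) P (poly-raise d (poly-scale d a Q)))
    , λ x → begin
    x * f x + a * (f x + a * g x) ≡⟨ cong (λ z → x * f x + a * z) (eq x) ⟩
    x * f x + a * (f a + x * g x) ≡⟨ solve 5 (λ x y a z w → x :* y :+ a :* (w :+ x :* z) := a :* w :+ x :* (y :+ a :* z)) refl x (f x) a (g x) (f a) ⟩
    a * f a + x * (f x + a * g x) ∎

  poly-^ : ∀ d → Poly d 1# (_^ d)
  poly-^ zero x = refl
  poly-^ (suc d) = poly-shift d (poly-^ d)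

  -- Induction by splitting off the first root a: at any other root y the quotient identity becomes
  -- a g(y) = y g(y), so g(y) = 0.
  manyRoots⇒leading≡0 : ∀ d {c f} → Poly d c f → (r : Fin (suc d) → Carrier) → Injective _≡_ _≡_ r →
                        (∀ i → f (r i) ≡ 0#) → c ≡ 0#
  manyRoots⇒leading≡0 zero P r inj root = trans (sym (P (r zero))) (root zero)
  manyRoots⇒leading≡0 (suc d) {f = f} P r inj root with P (r zero)
  ... | g , Q , eq = manyRoots⇒leading≡0 d Q (r ∘ suc) (Fin.suc-injective ∘ inj) root′
    where
    root′ : ∀ i → g (r (suc i)) ≡ 0#
    root′ i = decidable-stable (g y ≟ 0#) λ gy≢0 → Fin.0≢1+n (inj (*-cancelʳ (g y) gy≢0 (begin
      a * g y ≡⟨ +-identityˡ _ ⟨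
      0# + a * g y ≡⟨ cong (_+ a * g y) (root (suc i)) ⟨
      f y + a * g y ≡⟨ eq y ⟩
      f a + y * g y ≡⟨ cong (_+ y * g y) (root zero) ⟩
      0# + y * g y ≡⟨ +-identityˡ _ ⟩
      y * g y ∎)))
      where
      a = r zero
      y = r (suc i)

  -- Otherwise X(X^d - 1), of degree d + 1 and with leading coefficient 1, would vanish on the whole
  -- field, which has at least d + 2 elements. The factor X takes care of the requirement `x ≢ 0#`.
  ∃x^d≢1 : ∀ d → 1 ≤ d → suc (suc d) ≤ m → ∃ λ x → x ≢ 0# × x ^ d ≢ 1#
  ∃x^d≢1 (suc d) _ d+2≤m
    with Fin.any? (λ i → ¬? (elem i * (elem i ^ suc d + - 1#) ≟ 0#))
  ... | yes (i , neq) = elem i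
    , (λ eq → neq (trans (cong (_* (elem i ^ suc d + - 1#)) eq) (zeroˡ _)))
    , (λ eq → neq (trans (cong (λ z → elem i * (z + - 1#)) eq) (trans (cong (elem i *_) (-‿inverseʳ 1#)) (zeroʳ _))))
  ... | no none = contradiction (sym 1≡0) 0≢1
    where
    vanish : ∀ i → elem i * (elem i ^ suc d + - 1#) ≡ 0#
    vanish i = decidable-stable (_ ≟ 0#) λ neq → none (i , neq)
    1≡0 : 1# ≡ 0#
    1≡0 = trans (sym (+-identityʳ 1#))
      (manyRoots⇒leading≡0 (suc (suc d))
        (poly-shift (suc d) (poly-+ (suc d) (poly-^ (suc d)) (poly-const d (- 1#))))
        (λ i → elem (inject≤ i d+2≤m))
        (λ eq → Fin.inject≤-injective _ _ _ _ (Injection.injective (↔⇒↣ enumeration) eq))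
        (λ i → vanish (inject≤ i d+2≤m)))

  -- Pigeonhole: a missed value, prepended to the list of values of `f`, would give an injection of
  -- `Fin (suc m)` into `Fin m`.
  injective⇒bijective : ∀ {f : Carrier → Carrier} → Injective _≡_ _≡_ f → Bijective _≡_ _≡_ f
  injective⇒bijective {f} inj = inj , surjective
    where
    surjective : ∀ y → ∃ λ x → ∀ {z} → z ≡ x → f z ≡ y
    surjective y with Fin.any? (λ i → f (elem i) ≟ y)
    ... | yes (i , eq) = elem i , λ { refl → eq }
    ... | no missed = contradiction (Fin.injective⇒≤ {f = Inverse.from enumeration ∘ values} (values-injective ∘ Injection.injective (↔⇒↣ (↔-sym enumeration)))) ℕ.1+n≰n
      where
      values : Fin (suc m) → Carrier
      values zero = y
      values (suc i) = f (elem i)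

      values-injective : Injective _≡_ _≡_ values
      values-injective {zero} {zero} _ = refl
      values-injective {zero} {suc j} eq = contradiction (j , sym eq) missed
      values-injective {suc i} {zero} eq = contradiction (i , eq) missed
      values-injective {suc i} {suc j} eq = cong suc (Injection.injective (↔⇒↣ enumeration) (inj eq))

-- Powers with exponent coprime to the order

module PowerProperties {m} (F : FiniteField m) where
  open FiniteFieldProperties F

  x^k≡1⇒x^jk≡1 : ∀ {x} j k → x ^ k ≡ 1# → x ^ (j *ℕ k) ≡ 1#
  x^k≡1⇒x^jk≡1 {x} j k eq = begin
    x ^ (j *ℕ k) ≡⟨ ^-assocʳ x j k ⟨
    (x ^ j) ^ k  ≡⟨ ^-comm x j k ⟩
    (x ^ k) ^ j  ≡⟨ cong (_^ j) eq ⟩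
    1# ^ j       ≡⟨ 1^ j ⟩
    1#           ∎

  ⁻¹-root : ∀ {x} e → x ≢ 0# → x ^ e ≡ 1# → (x ⁻¹) ^ e ≡ 1#
  ⁻¹-root {x} e x≢0 eq = begin
    (x ⁻¹) ^ e            ≡⟨ *-identityʳ _ ⟨
    (x ⁻¹) ^ e * 1#       ≡⟨ cong ((x ⁻¹) ^ e *_) eq ⟨
    (x ⁻¹) ^ e * x ^ e    ≡⟨ ^-distrib-* (x ⁻¹) x e ⟨
    (x ⁻¹ * x) ^ e        ≡⟨ cong (_^ e) (inverseˡ x x≢0) ⟩
    1# ^ e                ≡⟨ 1^ e ⟩
    1#                    ∎

  -- Bézout gives either ik = 1 + je, with root x^i, or 1 + ik = je, with root (x⁻¹)^i.
  coprime⇒root : ∀ {x} k e → Coprime k e → x ≢ 0# → x ^ e ≡ 1# → ∃ λ y → y ^ e ≡ 1# × y ^ k ≡ x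
  coprime⇒root {x} k e coprime x≢0 x^e≡1 with coprime-Bézout coprime
  ... | Bézout.+- i j eq = x ^ i , trans (^-assocʳ x i e) (x^k≡1⇒x^jk≡1 i e x^e≡1) , (begin
    (x ^ i) ^ k        ≡⟨ ^-assocʳ x i k ⟩
    x ^ (i *ℕ k)       ≡⟨ cong (x ^_) eq ⟨
    x * x ^ (j *ℕ e)   ≡⟨ cong (x *_) (x^k≡1⇒x^jk≡1 j e x^e≡1) ⟩
    x * 1#             ≡⟨ *-identityʳ x ⟩
    x                  ∎)
  ... | Bézout.-+ i j eq = y ^ i , trans (^-assocʳ y i e) (x^k≡1⇒x^jk≡1 i e (⁻¹-root e x≢0 x^e≡1)) , (begin
    (y ^ i) ^ k                        ≡⟨ *-identityʳ _ ⟨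
    (y ^ i) ^ k * 1#                   ≡⟨ cong ((y ^ i) ^ k *_) (x^k≡1⇒x^jk≡1 j e x^e≡1) ⟨
    (y ^ i) ^ k * x ^ (j *ℕ e)         ≡⟨ cong (λ z → (y ^ i) ^ k * x ^ z) eq ⟨
    (y ^ i) ^ k * (x * x ^ (i *ℕ k))   ≡⟨ cong₂ (λ z w → z * (x * w)) (^-assocʳ y i k) refl ⟩
    y ^ (i *ℕ k) * (x * x ^ (i *ℕ k))
      ≡⟨ solve 3 (λ a b c → a :* (b :* c) := b :* (a :* c)) refl (y ^ (i *ℕ k)) x (x ^ (i *ℕ k)) ⟩
    x * (y ^ (i *ℕ k) * x ^ (i *ℕ k))  ≡⟨ cong (x *_) (^-distrib-* y x (i *ℕ k)) ⟨
    x * (y * x) ^ (i *ℕ k)             ≡⟨ cong (λ z → x * z ^ (i *ℕ k)) (inverseˡ x x≢0) ⟩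
    x * 1# ^ (i *ℕ k)                  ≡⟨ trans (cong (x *_) (1^ (i *ℕ k))) (*-identityʳ x) ⟩
    x                                  ∎)
    where y = x ⁻¹

  coprime⇒trivial : ∀ {x} k e → Coprime k e → x ^ e ≡ 1# → x ^ k ≡ 1# → x ≡ 1#
  coprime⇒trivial {x} k e coprime x^e≡1 x^k≡1 with coprime-Bézout coprime
  ... | Bézout.+- i j eq = begin
    x                  ≡⟨ *-identityʳ x ⟨
    x * 1#             ≡⟨ cong (x *_) (x^k≡1⇒x^jk≡1 j e x^e≡1) ⟨
    x * x ^ (j *ℕ e)   ≡⟨ cong (x ^_) eq ⟩
    x ^ (i *ℕ k)       ≡⟨ x^k≡1⇒x^jk≡1 i k x^k≡1 ⟩
    1#                 ∎
  ... | Bézout.-+ i j eq = begin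
    x                  ≡⟨ *-identityʳ x ⟨
    x * 1#             ≡⟨ cong (x *_) (x^k≡1⇒x^jk≡1 i k x^k≡1) ⟨
    x * x ^ (i *ℕ k)   ≡⟨ cong (x ^_) eq ⟩
    x ^ (j *ℕ e)       ≡⟨ x^k≡1⇒x^jk≡1 j e x^e≡1 ⟩
    1#                 ∎

  coprime⇒power-injective : ∀ {x y} k e → Coprime k e → x ^ e ≡ 1# → y ^ e ≡ 1# → y ≢ 0# → x ^ k ≡ y ^ k → x ≡ y
  coprime⇒power-injective {x} {y} k e coprime x^e≡1 y^e≡1 y≢0 eq = begin
    x                ≡⟨ *-identityʳ x ⟨
    x * 1#           ≡⟨ cong (x *_) (inverseˡ y y≢0) ⟨
    x * (y ⁻¹ * y)   ≡⟨ *-assoc x (y ⁻¹) y ⟨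
    x * y ⁻¹ * y     ≡⟨ cong (_* y) (coprime⇒trivial k e coprime
                           (trans (^-distrib-* x (y ⁻¹) e) (trans (cong₂ _*_ x^e≡1 (⁻¹-root e y≢0 y^e≡1)) (*-identityʳ 1#)))
                           (begin
      (x * y ⁻¹) ^ k       ≡⟨ ^-distrib-* x (y ⁻¹) k ⟩
      x ^ k * (y ⁻¹) ^ k   ≡⟨ cong (_* (y ⁻¹) ^ k) eq ⟩
      y ^ k * (y ⁻¹) ^ k   ≡⟨ ^-distrib-* y (y ⁻¹) k ⟨
      (y * y ⁻¹) ^ k       ≡⟨ cong (_^ k) (inverseʳ y y≢0) ⟩
      1# ^ k               ≡⟨ 1^ k ⟩
      1#                   ∎)) ⟩
    1# * y           ≡⟨ *-identityˡ y ⟩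
    y                ∎

-- Splitting the condition gcd(rn, q-1) = 1

gcd-*≡1⇒gcd≡1ˡ : ∀ r n k → gcd (r *ℕ n) k ≡ 1 → gcd r k ≡ 1
gcd-*≡1⇒gcd≡1ˡ r n k eq = ∣1⇒≡1 (subst (gcd r k ∣_) eq
  (gcd-greatest (∣m⇒∣m*n n (gcd[m,n]∣m r k)) (gcd[m,n]∣n r k)))

gcd-*≡1⇒gcd≡1ʳ : ∀ r n k → gcd (r *ℕ n) k ≡ 1 → gcd n k ≡ 1
gcd-*≡1⇒gcd≡1ʳ r n k eq = gcd-*≡1⇒gcd≡1ˡ n r k (trans (cong (λ j → gcd j k) (ℕ.*-comm n r)) eq)

gcd≡1⇒gcd-*≡1 : ∀ r n k → gcd r k ≡ 1 → gcd n k ≡ 1 → gcd (r *ℕ n) k ≡ 1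
gcd≡1⇒gcd-*≡1 r n k gcdʳ gcdⁿ = coprime⇒gcd≡1 λ {i} (i∣rn , i∣k) →
  gcd≡1⇒coprime {n} {k} gcdⁿ
    (coprime-divisor {i} {r} (λ (j∣i , j∣r) → gcd≡1⇒coprime {r} {k} gcdʳ (j∣r , ∣-trans j∣i i∣k)) i∣rn , i∣k)

-- The quadratic extension of F_q, with q = e + 1

module QuadraticExtension (e : ℕ) (1≤e : 1 ≤ e) (isPrimePower : IsPrimePower (suc e)) (F : FiniteField (suc e ^ℕ 2)) where
  open FiniteFieldProperties F public
  open PowerProperties F public

  q : ℕ
  q = suc e

  φ : Carrier → Carrier
  φ x = x ^ q

  φ-+ : ∀ x y → φ (x + y) ≡ φ x + φ y
  φ-+ x y = go isPrimePower
    where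
    go : IsPrimePower q → φ (x + y) ≡ φ x + φ y
    go (p , k , pr , _ , q≡p^k) = subst (λ j → (x + y) ^ j ≡ x ^ j + y ^ j) (sym q≡p^k)
      (frobenius^-+ pr (characteristic (k *ℕ 2) (trans (cong (_^ℕ 2) q≡p^k) (ℕ.^-*-assoc p k 2))) k x y)

  φ-* : ∀ x y → φ (x * y) ≡ φ x * φ y
  φ-* x y = ^-distrib-* x y q

  φ-involutive : ∀ x → φ (φ x) ≡ x
  φ-involutive x = begin
    (x ^ q) ^ q      ≡⟨ ^-assocʳ x q q ⟩
    x ^ (q *ℕ q)     ≡⟨ cong (λ j → x ^ (q *ℕ j)) (ℕ.*-identityʳ q) ⟨
    x ^ (q ^ℕ 2)     ≡⟨ x^m≡x (ℕ.m^n>0 q 2) x ⟩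
    x                ∎

  φ-0 : φ 0# ≡ 0#
  φ-0 = 0^ q (s≤s z≤n)

  -- Membership in the subfield F_q.
  Fixed : Carrier → Set
  Fixed x = φ x ≡ x

  fixed⇒x^e≡1 : ∀ {x} → x ≢ 0# → Fixed x → x ^ e ≡ 1#
  fixed⇒x^e≡1 {x} x≢0 fix = *-cancelˡ x x≢0 (trans fix (sym (*-identityʳ x)))

  x^e≡1⇒fixed : ∀ {x} → x ^ e ≡ 1# → Fixed x
  x^e≡1⇒fixed {x} eq = trans (cong (x *_) eq) (*-identityʳ x)

  fixed-* : ∀ {x y} → Fixed x → Fixed y → Fixed (x * y)
  fixed-* {x} {y} fx fy = trans (φ-* x y) (cong₂ _*_ fx fy)

  fixed-^ : ∀ {x} k → Fixed x → Fixed (x ^ k)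
  fixed-^ {x} k fx = trans (^-comm x k q) (cong (_^ k) fx)

  N : Carrier → Carrier
  N x = x * φ x

  N-fixed : ∀ x → Fixed (N x)
  N-fixed x = trans (φ-* x (φ x)) (trans (cong (φ x *_) (φ-involutive x)) (*-comm _ _))

  N-nonZero : ∀ {x} → x ≢ 0# → N x ≢ 0#
  N-nonZero x≢0 = *-nonZero x≢0 (^-nonZero q x≢0)

  x^[q²-1]≡1 : ∀ {x} → x ≢ 0# → x ^ (e *ℕ suc q) ≡ 1#
  x^[q²-1]≡1 {x} x≢0 = begin
    x ^ (e *ℕ suc q)  ≡⟨ cong (x ^_) (ℕ.*-comm e (suc q)) ⟩
    -- `N x` unfolds to `x ^ suc q`, and nonzero elements of F_q satisfy z^e = 1.
    x ^ (suc q *ℕ e)  ≡⟨ ^-assocʳ x (suc q) e ⟨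
    N x ^ e           ≡⟨ fixed⇒x^e≡1 (N-nonZero x≢0) (N-fixed x) ⟩
    1#                ∎

  -- Let d + 2 be the gcd, e = (j + 1)(d + 2) and h = (j + 1)(q + 1), so that h(d + 2) = q² - 1.
  -- Then x^h is a (d + 2)-th root of unity for every nonzero x, and `∃x^d≢1` supplies an x for
  -- which it is not 1.
  gcd≢1⇒nontrivialRoot : ∀ k → gcd k e ≢ 1 → ∃ λ x → x ≢ 1# × Fixed x × x ^ k ≡ 1#
  gcd≢1⇒nontrivialRoot k gcd≢1 with gcd k e | gcd[m,n]∣m k e | gcd[m,n]∣n k e
  ... | zero | _ | divides j e≡j0 = contradiction (subst (1 ≤_) (trans e≡j0 (ℕ.*-zeroʳ j)) 1≤e) λ ()
  ... | 1 | _ | _ = contradiction refl gcd≢1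
  ... | suc (suc d) | divides i k≡id | divides zero e≡jd = contradiction (subst (1 ≤_) e≡jd 1≤e) λ ()
  ... | suc (suc d) | divides i k≡id | divides (suc j) e≡jd with ∃x^d≢1 (suc j *ℕ suc q) (s≤s z≤n) bound
    where
    h = suc j *ℕ suc q
    -- 2h ≤ (d + 2)h = q² − 1 and 2 ≤ h.
    bound : suc (suc h) ≤ suc e ^ℕ 2
    bound = ℕ.≤-trans (ℕ.≤-trans (ℕ.≤-trans (ℕ.+-monoˡ-≤ h (s≤s (s≤s z≤n)))
                   (ℕ.≤-trans (ℕ.+-monoʳ-≤ h (ℕ.m≤m+n h (d *ℕ h))) (ℕ.≤-reflexive eq₁)))
                   (ℕ.n≤1+n _)) (ℕ.≤-reflexive eq₂)
      where
      open Data.Nat.Solver.+-*-Solver renaming (solve to solveℕ; _:+_ to _⊕_; _:*_ to _⊗_; _:=_ to _⊜_; con to conℕ)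
      eq₁ : suc (suc d) *ℕ h ≡ e *ℕ suc q
      eq₁ = trans (solveℕ 3 (λ a b c → a ⊗ (b ⊗ c) ⊜ (b ⊗ a) ⊗ c) refl (suc (suc d)) (suc j) (suc q))
                  (cong (_*ℕ suc q) (sym e≡jd))
      eq₂ : suc (e *ℕ suc q) ≡ suc e ^ℕ 2
      eq₂ = solveℕ 1 (λ e → conℕ 1 ⊕ e ⊗ (conℕ 2 ⊕ e) ⊜ (conℕ 1 ⊕ e) ⊗ ((conℕ 1 ⊕ e) ⊗ conℕ 1)) refl e
  ... | x , x≢0 , x^h≢1 = x ^ h , x^h≢1
      , x^e≡1⇒fixed (subst (λ z → (x ^ h) ^ z ≡ 1#) (sym e≡jd) (x^k≡1⇒x^jk≡1 (suc j) (suc (suc d)) y^d≡1))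
      , subst (λ z → (x ^ h) ^ z ≡ 1#) (sym k≡id) (x^k≡1⇒x^jk≡1 i (suc (suc d)) y^d≡1)
    where
    h = suc j *ℕ suc q
    y^d≡1 : (x ^ h) ^ suc (suc d) ≡ 1#
    y^d≡1 = begin
      (x ^ h) ^ suc (suc d)            ≡⟨ ^-assocʳ x h (suc (suc d)) ⟩
      x ^ (suc j *ℕ suc q *ℕ suc (suc d))   ≡⟨ cong (x ^_) (ℕ.*-assoc (suc j) (suc q) (suc (suc d))) ⟩
      x ^ (suc j *ℕ (suc q *ℕ suc (suc d)))   ≡⟨ cong (λ z → x ^ (suc j *ℕ z)) (ℕ.*-comm (suc q) (suc (suc d))) ⟩
      x ^ (suc j *ℕ (suc (suc d) *ℕ suc q))   ≡⟨ cong (x ^_) (ℕ.*-assoc (suc j) (suc (suc d)) (suc q)) ⟨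
      x ^ (suc j *ℕ suc (suc d) *ℕ suc q)   ≡⟨ cong (λ z → x ^ (z *ℕ suc q)) e≡jd ⟨
      x ^ (e *ℕ suc q)                 ≡⟨ x^[q²-1]≡1 x≢0 ⟩
      1#                               ∎

  -- The hypothesis is (u - v)(x - y) = 0 with the negative terms moved across, a form that the
  -- semiring solver can produce.
  cross-cancel : ∀ {u v x y} → u ≢ v → u * x + v * y ≡ u * y + v * x → x ≡ y
  cross-cancel {u} {v} {x} {y} u≢v eq = *-cancelˡ w (u≢v ∘ x-y≡0⇒x≡y u v) (+-cancelʳ (v * x + v * y) _ _ (begin
    w * x + (v * x + v * y)   ≡⟨ solve 4 (λ w v x y → w :* x :+ (v :* x :+ v :* y) := (w :+ v) :* x :+ v :* y) refl w v x y ⟩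
    (w + v) * x + v * y       ≡⟨ cong (λ z → z * x + v * y) w+v≡u ⟩
    u * x + v * y             ≡⟨ eq ⟩
    u * y + v * x             ≡⟨ cong (λ z → z * y + v * x) w+v≡u ⟨
    (w + v) * y + v * x       ≡⟨ solve 4 (λ w v x y → (w :+ v) :* y :+ v :* x := w :* y :+ (v :* x :+ v :* y)) refl w v x y ⟩
    w * y + (v * x + v * y)   ∎))
    where
    w = u - v
    w+v≡u : w + v ≡ u
    w+v≡u = x-y+y≡x u v

  -- The maps L_c and the lines W(c)

  L : Carrier → Carrier → Carrier
  L c x = φ x + x * c

  L-scale : ∀ c {λ′} x → Fixed λ′ → L c (λ′ * x) ≡ λ′ * L c x
  L-scale c {l} x fix = begin
    φ (l * x) + l * x * c   ≡⟨ cong (_+ l * x * c) (trans (φ-* l x) (cong (_* φ x) fix)) ⟩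
    l * φ x + l * x * c     ≡⟨ solve 4 (λ l x c y → l :* y :+ l :* x :* c := l :* (y :+ x :* c)) refl l x c (φ x) ⟩
    l * (φ x + x * c)       ∎

  L-0 : ∀ c → L c 0# ≡ 0#
  L-0 c = trans (cong₂ _+_ φ-0 (zeroˡ c)) (+-identityʳ 0#)

  -- Adding the equations crosswise puts φ(x) + φ(y) on both sides, and what remains is linear in x
  -- and y.
  L-injective : ∀ {u v x y} → u ≢ v → L u x ≡ L u y → L v x ≡ L v y → x ≡ y
  L-injective {u} {v} {x} {y} u≢v eqᵤ eqᵥ = cross-cancel u≢v (+-cancelˡ (φ x + φ y) _ _ (begin
    φ x + φ y + (u * x + v * y)
      ≡⟨ solve 6 (λ a b u v x y → a :+ b :+ (u :* x :+ v :* y) := (a :+ x :* u) :+ (b :+ y :* v)) refl (φ x) (φ y) u v x y ⟩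
    L u x + L v y   ≡⟨ cong₂ _+_ eqᵤ (sym eqᵥ) ⟩
    L u y + L v x
      ≡⟨ solve 6 (λ a b u v x y → (b :+ y :* u) :+ (a :+ x :* v) := a :+ b :+ (u :* y :+ v :* x)) refl (φ x) (φ y) u v x y ⟩
    φ x + φ y + (u * y + v * x) ∎))

  W : Carrier → Carrier → Set
  W c w = φ w * c ≡ w

  W-+ : ∀ {c w z} → W c w → W c z → W c (w + z)
  W-+ {c} {w} {z} Ww Wz = trans (cong (_* c) (φ-+ w z)) (trans (distribʳ c (φ w) (φ z)) (cong₂ _+_ Ww Wz))

  W-neg : ∀ {c w} → W c w → W c (- w)
  W-neg {c} {w} Ww = x+y≡0⇒x≡-y (φ (- w) * c) w (begin
    φ (- w) * c + w         ≡⟨ cong (φ (- w) * c +_) Ww ⟨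
    φ (- w) * c + φ w * c   ≡⟨ distribʳ c (φ (- w)) (φ w) ⟨
    (φ (- w) + φ w) * c     ≡⟨ cong (_* c) (φ-+ (- w) w) ⟨
    φ (- w + w) * c         ≡⟨ cong (λ z → φ z * c) (trans (+-comm (- w) w) (-‿inverseʳ w)) ⟩
    φ 0# * c                ≡⟨ cong (_* c) φ-0 ⟩
    0# * c                  ≡⟨ zeroˡ c ⟩
    0#                      ∎)

  W-scale : ∀ {c λ′ w} → Fixed λ′ → W c w → W c (λ′ * w)
  W-scale {c} {l} {w} fix Ww = begin
    φ (l * w) * c    ≡⟨ cong (_* c) (trans (φ-* l w) (cong (_* φ w) fix)) ⟩
    l * φ w * c      ≡⟨ *-assoc l (φ w) c ⟩
    l * (φ w * c)    ≡⟨ cong (l *_) Ww ⟩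
    l * w            ∎

  W-^ : ∀ {c w} n → W c w → W (c ^ n) (w ^ n)
  W-^ {c} {w} n Ww = begin
    φ (w ^ n) * c ^ n    ≡⟨ cong (_* c ^ n) (^-comm w n q) ⟩
    φ w ^ n * c ^ n      ≡⟨ ^-distrib-* (φ w) c n ⟨
    (φ w * c) ^ n        ≡⟨ cong (_^ n) Ww ⟩
    w ^ n                ∎

  L∈W : ∀ {c} x → φ c * c ≡ 1# → W c (L c x)
  L∈W {c} x unit = begin
    φ (φ x + x * c) * c            ≡⟨ cong (_* c) (trans (φ-+ (φ x) (x * c)) (cong₂ _+_ (φ-involutive x) (φ-* x c))) ⟩
    (x + φ x * φ c) * c            ≡⟨ solve 4 (λ x y d c → (x :+ y :* d) :* c := y :* (d :* c) :+ x :* c) refl x (φ x) (φ c) c ⟩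
    φ x * (φ c * c) + x * c        ≡⟨ cong (λ z → φ x * z + x * c) unit ⟩
    φ x * 1# + x * c               ≡⟨ cong (_+ x * c) (*-identityʳ (φ x)) ⟩
    L c x                          ∎

  -- One-dimensionality over F_q: applying φ to z = l w and multiplying by c preserves z and w and
  -- replaces l by φ(l).
  W-ratio : ∀ {c w z} → W c w → W c z → w ≢ 0# → ∃ λ λ′ → Fixed λ′ × z ≡ λ′ * w
  W-ratio {c} {w} {z} Ww Wz w≢0 = l , *-cancelʳ w w≢0 (begin
    φ l * w              ≡⟨ cong (φ l *_) Ww ⟨
    φ l * (φ w * c)      ≡⟨ *-assoc (φ l) (φ w) c ⟨
    φ l * φ w * c        ≡⟨ cong (_* c) (φ-* l w) ⟨
    φ (l * w) * c        ≡⟨ cong (λ y → φ y * c) z≡lw ⟨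
    φ z * c              ≡⟨ Wz ⟩
    z                    ≡⟨ z≡lw ⟩
    l * w                ∎) , z≡lw
    where
    l = z / w
    z≡lw : z ≡ l * w
    z≡lw = sym (trans (*-assoc z (w ⁻¹) w) (trans (cong (z *_) (inverseˡ w w≢0)) (*-identityʳ z)))

  -- L_c(1) = 1 + c vanishes only for c = -1. In that case L_c(x) = x(x^e - 1), so any nonzero x
  -- with x^e ≠ 1 serves.
  W-nontrivial : ∀ {c} → φ c * c ≡ 1# → ∃ λ w → w ≢ 0# × W c w
  W-nontrivial {c} unit with L c 1# ≟ 0#
  ... | no L1≢0 = L c 1# , L1≢0 , L∈W 1# unit
  ... | yes L1≡0 with ∃x^d≢1 e 1≤e bound
    where
    bound : suc (suc e) ≤ suc e ^ℕ 2
    bound = ℕ.≤-trans (ℕ.+-monoˡ-≤ q (s≤s z≤n)) (ℕ.≤-trans (ℕ.≤-reflexive (cong (q +ℕ_) (sym (ℕ.*-identityˡ q))))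
      (ℕ.≤-trans (ℕ.*-monoˡ-≤ q (s≤s 1≤e)) (ℕ.≤-reflexive (cong (q *ℕ_) (sym (ℕ.*-identityʳ q))))))
  ... | x , x≢0 , x^e≢1 = L c x , Lx≢0 , L∈W x unit
    where
    Lx≢0 : L c x ≢ 0#
    Lx≢0 Lx≡0 = x^e≢1 (+-cancelʳ c _ _ (*-cancelˡ x x≢0 (begin
      x * (x ^ e + c)   ≡⟨ distribˡ x (x ^ e) c ⟩
      L c x             ≡⟨ Lx≡0 ⟩
      0#                ≡⟨ zeroʳ x ⟨
      x * 0#            ≡⟨ cong (x *_) (trans (sym L1≡0) (cong₂ _+_ (1^ q) (*-identityˡ c))) ⟩
      x * (1# + c)      ∎)))

  -- The solution is x = (s − t) / (u − v).
  L-interpolate : ∀ {u v s t} → φ u * u ≡ 1# → φ v * v ≡ 1# → u ≢ v → W u s → W v t →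
                  ∃ λ x → L u x ≡ s × L v x ≡ t
  L-interpolate {u} {v} {s} {t} unitᵤ unitᵥ u≢v Ws Wt = x , Lᵤ , Lᵥ
    where
    w = u - v
    w≢0 : w ≢ 0#
    w≢0 = u≢v ∘ x-y≡0⇒x≡y u v
    x = (s - t) / w

    -- The difference L_u(x) - L_v(x) = s - t, in which φ(x) cancels, written without subtraction.
    eq₁ : x * u + t ≡ s + x * v
    eq₁ = begin
      x * u + t               ≡⟨ cong (λ z → x * z + t) (x-y+y≡x u v) ⟨
      x * (w + v) + t         ≡⟨ solve 4 (λ x w v t → x :* (w :+ v) :+ t := (x :* w :+ t) :+ x :* v) refl x w v t ⟩
      (x * w + t) + x * v     ≡⟨ cong (λ z → z + t + x * v) (trans (*-assoc (s - t) (w ⁻¹) w) (trans (cong ((s - t) *_) (inverseˡ w w≢0)) (*-identityʳ (s - t)))) ⟩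
      ((s - t) + t) + x * v   ≡⟨ cong (_+ x * v) (x-y+y≡x s t) ⟩
      s + x * v               ∎

    -- φ applied to eq₁ and multiplied by uv.
    eq₂ : φ x * v + t * u ≡ s * v + φ x * u
    eq₂ = begin
      φ x * v + t * u        ≡⟨ cong (λ y → y * v + t * u) (*-identityʳ (φ x)) ⟨
      φ x * 1# * v + t * u   ≡⟨ cong₂ (λ y z → φ x * y * v + z * u) (sym unitᵤ) (sym Wt) ⟩
      φ x * (φ u * u) * v + φ t * v * u
        ≡⟨ solve 5 (λ y d u v r → y :* (d :* u) :* v :+ r :* v :* u := (y :* d :+ r) :* (u :* v)) refl (φ x) (φ u) u v (φ t) ⟩
      (φ x * φ u + φ t) * (u * v)   ≡⟨ cong (_* (u * v)) (trans (cong (_+ φ t) (sym (φ-* x u))) (sym (φ-+ (x * u) t))) ⟩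
      φ (x * u + t) * (u * v)       ≡⟨ cong (λ z → φ z * (u * v)) eq₁ ⟩
      φ (s + x * v) * (u * v)       ≡⟨ cong (_* (u * v)) (trans (φ-+ s (x * v)) (cong (φ s +_) (φ-* x v))) ⟩
      (φ s + φ x * φ v) * (u * v)
        ≡⟨ solve 5 (λ y d u v r → (r :+ y :* d) :* (u :* v) := r :* u :* v :+ y :* (d :* v) :* u) refl (φ x) (φ v) u v (φ s) ⟩
      φ s * u * v + φ x * (φ v * v) * u ≡⟨ cong₂ (λ y z → y * v + φ x * z * u) Ws unitᵥ ⟩
      s * v + φ x * 1# * u              ≡⟨ cong (λ z → s * v + z * u) (*-identityʳ (φ x)) ⟩
      s * v + φ x * u                   ∎

    Lᵤ : L u x ≡ s
    -- φ(x) is accessible only through `eq₂`, multiplied by u - v; hence (u - v) L_u(x) = (u - v) s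
    -- is shown first.
    Lᵤ = cross-cancel u≢v (begin
      u * (φ x + x * u) + v * s
        ≡⟨ solve 5 (λ u v s x y → u :* (y :+ x :* u) :+ v :* s := (s :* v :+ y :* u) :+ u :* (x :* u)) refl u v s x (φ x) ⟩
      (s * v + φ x * u) + u * (x * u)   ≡⟨ cong (_+ u * (x * u)) eq₂ ⟨
      (φ x * v + t * u) + u * (x * u)
        ≡⟨ solve 5 (λ u v t x y → (y :* v :+ t :* u) :+ u :* (x :* u) := y :* v :+ u :* (x :* u :+ t)) refl u v t x (φ x) ⟩
      φ x * v + u * (x * u + t)         ≡⟨ cong (λ z → φ x * v + u * z) eq₁ ⟩
      φ x * v + u * (s + x * v)
        ≡⟨ solve 5 (λ u v s x y → y :* v :+ u :* (s :+ x :* v) := u :* s :+ v :* (y :+ x :* u)) refl u v s x (φ x) ⟩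
      u * s + v * (φ x + x * u) ∎)

    Lᵥ : L v x ≡ t
    Lᵥ = +-cancelˡ (x * u) _ _ (begin
      x * u + (φ x + x * v)   ≡⟨ solve 3 (λ a b y → a :+ (y :+ b) := (y :+ a) :+ b) refl (x * u) (x * v) (φ x) ⟩
      L u x + x * v           ≡⟨ cong (_+ x * v) Lᵤ ⟩
      s + x * v               ≡⟨ eq₁ ⟨
      x * u + t               ∎)

  -- Rewriting f through norms and the maps L_u, L_v

  module PermutationCriterion
    (r n : ℕ) (1≤r : 1 ≤ r) (1≤n : 1 ≤ n) (r≡n : r % suc q ≡ n % suc q)
    (u v : Carrier) (unitᵤ : φ u * u ≡ 1#) (unitᵥ : φ v * v ≡ 1#) (u≢v : u ≢ v)
    (a b : Carrier) (a≢0 : a ≢ 0#) (b≢0 : b ≢ 0#)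
    where

    B f : Carrier → Carrier
    B X = a * (X + u) ^ n + b * (X + v) ^ n
    f X = X ^ r * B (X ^ e)

    G : Carrier → Carrier → Carrier
    G s t = a * s ^ n + b * t ^ n

    -- With α = r / (q+1), the congruence gives r - n = (α - j)(q + 1), possibly negative. Adding
    -- j(q² - 1) = je(q + 1) to the exponent does not change powers of nonzero elements, and α - j +
    -- je = α + j(e - 1) is a natural number.
    k j : ℕ
    k = r /ℕ suc q +ℕ (n /ℕ suc q) *ℕ (e ∸ 1)
    j = n /ℕ suc q

    exponents : r +ℕ j *ℕ (e *ℕ suc q) ≡ n +ℕ k *ℕ suc q
    exponents = begin
      r +ℕ j *ℕ (e *ℕ suc q)
        ≡⟨ cong (_+ℕ j *ℕ (e *ℕ suc q)) (trans (m≡m%n+[m/n]*n r (suc q)) (cong (_+ℕ α *ℕ suc q) r≡n)) ⟩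
      ρ +ℕ α *ℕ suc q +ℕ j *ℕ (e *ℕ suc q)
        ≡⟨ cong (λ i → ρ +ℕ α *ℕ suc q +ℕ j *ℕ (i *ℕ suc q)) (ℕ.m+[n∸m]≡n 1≤e) ⟨
      ρ +ℕ α *ℕ suc q +ℕ j *ℕ ((1 +ℕ (e ∸ 1)) *ℕ suc q)
        ≡⟨ solveℕ 5 (λ ρ α j i Q → ρ ⊕ α ⊗ Q ⊕ j ⊗ ((conℕ 1 ⊕ i) ⊗ Q) ⊜ ρ ⊕ j ⊗ Q ⊕ (α ⊕ j ⊗ i) ⊗ Q) refl ρ α j (e ∸ 1) (suc q) ⟩
      ρ +ℕ j *ℕ suc q +ℕ k *ℕ suc q
        ≡⟨ cong (_+ℕ k *ℕ suc q) (m≡m%n+[m/n]*n n (suc q)) ⟨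
      n +ℕ k *ℕ suc q ∎
      where
      open Data.Nat.Solver.+-*-Solver renaming (solve to solveℕ; _:+_ to _⊕_; _:*_ to _⊗_; _:=_ to _⊜_; con to conℕ)
      ρ = n % suc q
      α = r /ℕ suc q

    x^r≡ : ∀ {x} → x ≢ 0# → x ^ r ≡ x ^ n * N x ^ k
    x^r≡ {x} x≢0 = begin
      x ^ r                                  ≡⟨ *-identityʳ _ ⟨
      x ^ r * 1#                             ≡⟨ cong (x ^ r *_) (x^k≡1⇒x^jk≡1 j (e *ℕ suc q) (x^[q²-1]≡1 x≢0)) ⟨
      x ^ r * x ^ (j *ℕ (e *ℕ suc q))        ≡⟨ ^-homo-* x r _ ⟨
      x ^ (r +ℕ j *ℕ (e *ℕ suc q))           ≡⟨ cong (x ^_) exponents ⟩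
      x ^ (n +ℕ k *ℕ suc q)                  ≡⟨ ^-homo-* x n (k *ℕ suc q) ⟩
      x ^ n * x ^ (k *ℕ suc q)               ≡⟨ cong (x ^ n *_) (trans (sym (^-assocʳ x k (suc q))) (^-comm x k (suc q))) ⟩
      x ^ n * N x ^ k                        ∎

    f-0 : f 0# ≡ 0#
    f-0 = trans (cong (_* B (0# ^ e)) (0^ r 1≤r)) (zeroˡ _)

    f≡ : ∀ {x} → x ≢ 0# → f x ≡ N x ^ k * G (L u x) (L v x)
    f≡ {x} x≢0 = begin
      x ^ r * (a * (x ^ e + u) ^ n + b * (x ^ e + v) ^ n)   ≡⟨ cong (_* B (x ^ e)) (x^r≡ x≢0) ⟩
      x ^ n * M * (a * (x ^ e + u) ^ n + b * (x ^ e + v) ^ n)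
        ≡⟨ solve 6 (λ X M a b s t → X :* M :* (a :* s :+ b :* t) := M :* (a :* (X :* s) :+ b :* (X :* t)))
             refl (x ^ n) M a b ((x ^ e + u) ^ n) ((x ^ e + v) ^ n) ⟩
      M * (a * (x ^ n * (x ^ e + u) ^ n) + b * (x ^ n * (x ^ e + v) ^ n))
        ≡⟨ cong₂ (λ s t → M * (a * s + b * t)) (absorb u) (absorb v) ⟩
      M * G (L u x) (L v x) ∎
      where
      M = N x ^ k
      absorb : ∀ c → x ^ n * (x ^ e + c) ^ n ≡ L c x ^ n
      absorb c = trans (sym (^-distrib-* x (x ^ e + c) n)) (cong (_^ n) (distribˡ x (x ^ e) c))

    f-scale : ∀ {λ′} x → λ′ ^ e ≡ 1# → f (λ′ * x) ≡ λ′ ^ r * f x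
    f-scale {l} x l^e≡1 = begin
      (l * x) ^ r * B ((l * x) ^ e)
        ≡⟨ cong₂ (λ y z → y * B z) (^-distrib-* l x r)
             (trans (^-distrib-* l x e) (trans (cong (_* x ^ e) l^e≡1) (*-identityˡ (x ^ e)))) ⟩
      l ^ r * x ^ r * B (x ^ e)     ≡⟨ *-assoc (l ^ r) (x ^ r) (B (x ^ e)) ⟩
      l ^ r * f x                   ∎

    -- Directness of the sum of the two lines

    -- The sum aW(uⁿ) + bW(vⁿ) fails to be direct exactly when the discriminants agree.
    d₁ d₂ : Carrier
    d₁ = φ b * a * u ^ n
    d₂ = φ a * b * v ^ n

    u≢0 : u ≢ 0#
    u≢0 refl = 0≢1 (trans (sym (zeroʳ (φ 0#))) unitᵤ)

    v≢0 : v ≢ 0#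
    v≢0 refl = 0≢1 (trans (sym (zeroʳ (φ 0#))) unitᵥ)

    private
      -- The common factor a^e uⁿ b a clears the denominators of both ratios and completes b^e and
      -- a^e to φ(b) and φ(a).
      d₁≡ : (b / a) ^ e * (a ^ e * u ^ n * (b * a)) ≡ d₁
      d₁≡ = begin
        (b / a) ^ e * (a ^ e * u ^ n * (b * a))
          ≡⟨ solve 5 (λ x y u a b → x :* (y :* u :* (b :* a)) := x :* y :* b :* a :* u) refl ((b / a) ^ e) (a ^ e) (u ^ n) a b ⟩
        (b / a) ^ e * a ^ e * b * a * u ^ n
          ≡⟨ cong (λ x → x * b * a * u ^ n) (trans (sym (^-distrib-* (b / a) a e)) (cong (_^ e) b/a*a≡b)) ⟩
        b ^ e * b * a * u ^ n ≡⟨ cong (λ x → x * a * u ^ n) (*-comm (b ^ e) b) ⟩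
        d₁ ∎
        where
        b/a*a≡b = trans (*-assoc b (a ⁻¹) a) (trans (cong (b *_) (inverseˡ a a≢0)) (*-identityʳ b))

      d₂≡ : (v / u) ^ n * (a ^ e * u ^ n * (b * a)) ≡ d₂
      d₂≡ = begin
        (v / u) ^ n * (a ^ e * u ^ n * (b * a))
          ≡⟨ solve 5 (λ x y u a b → x :* (y :* u :* (b :* a)) := a :* y :* b :* (x :* u)) refl ((v / u) ^ n) (a ^ e) (u ^ n) a b ⟩
        φ a * b * ((v / u) ^ n * u ^ n)
          ≡⟨ cong (φ a * b *_) (trans (sym (^-distrib-* (v / u) u n)) (cong (_^ n) v/u*u≡v)) ⟩
        d₂ ∎
        where
        v/u*u≡v = trans (*-assoc v (u ⁻¹) u) (trans (cong (v *_) (inverseˡ u u≢0)) (*-identityʳ v))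

    ratio≡⇒d₁≡d₂ : (b / a) ^ e ≡ (v / u) ^ n → d₁ ≡ d₂
    ratio≡⇒d₁≡d₂ eq = trans (sym d₁≡) (trans (cong (_* _) eq) d₂≡)

    d₁≡d₂⇒ratio≡ : d₁ ≡ d₂ → (b / a) ^ e ≡ (v / u) ^ n
    d₁≡d₂⇒ratio≡ eq = *-cancelʳ _
      (*-nonZero (*-nonZero (^-nonZero e a≢0) (^-nonZero n u≢0)) (*-nonZero b≢0 a≢0))
      (trans d₁≡ (trans eq (sym d₂≡)))

    -- Applying φ to the equation and multiplying by uⁿvⁿ gives a second linear equation in s and t.
    -- The determinant of the system is d₁ - d₂.
    kernel-trivial : ∀ {s t} → d₁ ≢ d₂ → W (u ^ n) s → W (v ^ n) t → a * s + b * t ≡ 0# → s ≡ 0# × t ≡ 0#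
    kernel-trivial {s} {t} d₁≢d₂ Ws Wt eq = s≡0 , t≡0
      where
      conjugate : φ a * s * v ^ n + φ b * t * u ^ n ≡ 0#
      conjugate = begin
        φ a * s * v ^ n + φ b * t * u ^ n
          ≡⟨ cong₂ (λ y z → φ a * y * v ^ n + φ b * z * u ^ n) Ws Wt ⟨
        φ a * (φ s * u ^ n) * v ^ n + φ b * (φ t * v ^ n) * u ^ n
          ≡⟨ solve 6 (λ a s b t u v → a :* (s :* u) :* v :+ b :* (t :* v) :* u := (a :* s :+ b :* t) :* (u :* v))
               refl (φ a) (φ s) (φ b) (φ t) (u ^ n) (v ^ n) ⟩
        (φ a * φ s + φ b * φ t) * (u ^ n * v ^ n)
          ≡⟨ cong (_* (u ^ n * v ^ n)) (sym (trans (φ-+ (a * s) (b * t)) (cong₂ _+_ (φ-* a s) (φ-* b t)))) ⟩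
        φ (a * s + b * t) * (u ^ n * v ^ n) ≡⟨ cong (λ z → φ z * (u ^ n * v ^ n)) eq ⟩
        φ 0# * (u ^ n * v ^ n)              ≡⟨ trans (cong (_* (u ^ n * v ^ n)) φ-0) (zeroˡ _) ⟩
        0# ∎

      d₁s≡d₂s : d₁ * s ≡ d₂ * s
      d₁s≡d₂s = begin
        φ b * a * u ^ n * s         ≡⟨ +-identityʳ _ ⟨
        φ b * a * u ^ n * s + 0#    ≡⟨ cong (φ b * a * u ^ n * s +_) (trans (cong (b *_) conjugate) (zeroʳ b)) ⟨
        φ b * a * u ^ n * s + b * (φ a * s * v ^ n + φ b * t * u ^ n)
          ≡⟨ solve 8 (λ a b a′ b′ s t u v → b′ :* a :* u :* s :+ b :* (a′ :* s :* v :+ b′ :* t :* u)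
                                         := a′ :* b :* v :* s :+ b′ :* u :* (a :* s :+ b :* t))
               refl a b (φ a) (φ b) s t (u ^ n) (v ^ n) ⟩
        d₂ * s + φ b * u ^ n * (a * s + b * t)
          ≡⟨ cong (d₂ * s +_) (trans (cong (φ b * u ^ n *_) eq) (zeroʳ _)) ⟩
        d₂ * s + 0#                 ≡⟨ +-identityʳ _ ⟩
        d₂ * s                      ∎

      s≡0 : s ≡ 0#
      s≡0 = decidable-stable (s ≟ 0#) λ s≢0 → d₁≢d₂ (*-cancelʳ s s≢0 d₁s≡d₂s)

      t≡0 : t ≡ 0#
      t≡0 = *-cancelˡ b b≢0 (begin
        b * t             ≡⟨ +-identityˡ _ ⟨
        0# + b * t        ≡⟨ cong (_+ b * t) (trans (cong (a *_) s≡0) (zeroʳ a)) ⟨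
        a * s + b * t     ≡⟨ eq ⟩
        0#                ≡⟨ zeroʳ b ⟨
        b * 0#            ∎)

    sum-direct : ∀ {s t s′ t′} → d₁ ≢ d₂ → W (u ^ n) s → W (v ^ n) t → W (u ^ n) s′ → W (v ^ n) t′ →
                 a * s + b * t ≡ a * s′ + b * t′ → s ≡ s′ × t ≡ t′
    sum-direct {s} {t} {s′} {t′} d₁≢d₂ Ws Wt Ws′ Wt′ eq =
      let δ≡0 , ε≡0 = kernel-trivial d₁≢d₂ (W-+ Ws (W-neg Ws′)) (W-+ Wt (W-neg Wt′)) difference
      in x-y≡0⇒x≡y s s′ δ≡0 , x-y≡0⇒x≡y t t′ ε≡0
      where
      difference : a * (s - s′) + b * (t - t′) ≡ 0#
      difference = +-cancelʳ (a * s′ + b * t′) _ _ (begin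
        a * (s - s′) + b * (t - t′) + (a * s′ + b * t′)
          ≡⟨ solve 6 (λ a b x y s t → a :* x :+ b :* y :+ (a :* s :+ b :* t) := a :* (x :+ s) :+ b :* (y :+ t))
               refl a b (s - s′) (t - t′) s′ t′ ⟩
        a * (s - s′ + s′) + b * (t - t′ + t′)   ≡⟨ cong₂ (λ x y → a * x + b * y) (x-y+y≡x s s′) (x-y+y≡x t t′) ⟩
        a * s + b * t                           ≡⟨ eq ⟩
        a * s′ + b * t′                         ≡⟨ +-identityˡ _ ⟨
        0# + (a * s′ + b * t′)                  ∎)

    -- Sufficiency

    -- Both sides of f x = f y lie in aW(uⁿ) + bW(vⁿ), so the components can be compared.
    f≡f⇒components≡ : ∀ {x y} → d₁ ≢ d₂ → x ≢ 0# → y ≢ 0# → f x ≡ f y →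
      (N x ^ k * L u x ^ n ≡ N y ^ k * L u y ^ n) × (N x ^ k * L v x ^ n ≡ N y ^ k * L v y ^ n)
    f≡f⇒components≡ {x} {y} d₁≢d₂ x≢0 y≢0 eq =
      sum-direct d₁≢d₂ (component u x unitᵤ) (component v x unitᵥ) (component u y unitᵤ) (component v y unitᵥ)
        (trans (sym (expand x≢0)) (trans eq (expand y≢0)))
      where
      component : ∀ c z → φ c * c ≡ 1# → W (c ^ n) (N z ^ k * L c z ^ n)
      component c z unit = W-scale (fixed-^ k (N-fixed z)) (W-^ n (L∈W z unit))
      expand : ∀ {z} → z ≢ 0# → f z ≡ a * (N z ^ k * L u z ^ n) + b * (N z ^ k * L v z ^ n)
      expand {z} z≢0 = trans (f≡ z≢0)
        (solve 5 (λ M a b s t → M :* (a :* s :+ b :* t) := a :* (M :* s) :+ b :* (M :* t)) refl (N z ^ k) a b (L u z ^ n) (L v z ^ n))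

    f-nonZero : ∀ {x} → d₁ ≢ d₂ → x ≢ 0# → f x ≢ 0#
    f-nonZero {x} d₁≢d₂ x≢0 fx≡0 =
      let Lᵤ≡0 , Lᵥ≡0 = kernel-trivial d₁≢d₂ (W-^ n (L∈W x unitᵤ)) (W-^ n (L∈W x unitᵥ)) G≡0
      in x≢0 (L-injective u≢v (trans (x^n≡0⇒x≡0 n Lᵤ≡0) (sym (L-0 u))) (trans (x^n≡0⇒x≡0 n Lᵥ≡0) (sym (L-0 v))))
      where
      G≡0 : G (L u x) (L v x) ≡ 0#
      G≡0 = *-cancelˡ (N x ^ k) (^-nonZero k (N-nonZero x≢0)) (trans (sym (f≡ x≢0)) (trans fx≡0 (sym (zeroʳ _))))

    -- Here M and M′ stand for N(x)ᵏ and N(y)ᵏ.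
    components≡⇒proportional : ∀ {c d x y M M′} → φ c * c ≡ 1# → φ d * d ≡ 1# → c ≢ d → Coprime n e →
      M ≢ 0# → M′ ≢ 0# → L c x ≢ 0# →
      M * L c x ^ n ≡ M′ * L c y ^ n → M * L d x ^ n ≡ M′ * L d y ^ n → ∃ λ λ′ → Fixed λ′ × y ≡ λ′ * x
    components≡⇒proportional {c} {d} {x} {y} {M} {M′} unit unit′ c≢d coprime M≢0 M′≢0 s≢0 eqᶜ eqᵈ
      with W-ratio (L∈W x unit) (L∈W y unit) s≢0
    ... | l , fix , s′≡ls = l , fix ,
      L-injective c≢d (trans s′≡ls (sym (L-scale c x fix))) (trans t′≡lt (sym (L-scale d x fix)))
      where
      s t t′ : Carrier
      s = L c x
      t = L d x
      t′ = L d y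

      cancelled : ∀ {s s′ l} → s ≢ 0# → s′ ≡ l * s → M * s ^ n ≡ M′ * s′ ^ n → M ≡ M′ * l ^ n
      cancelled {s} {s′} {l} s≢0 s′≡ls eq = *-cancelʳ (s ^ n) (^-nonZero n s≢0) (begin
        M * s ^ n              ≡⟨ eq ⟩
        M′ * s′ ^ n            ≡⟨ cong (λ z → M′ * z ^ n) s′≡ls ⟩
        M′ * (l * s) ^ n       ≡⟨ cong (M′ *_) (^-distrib-* l s n) ⟩
        M′ * (l ^ n * s ^ n)   ≡⟨ *-assoc M′ (l ^ n) (s ^ n) ⟨
        M′ * l ^ n * s ^ n     ∎)

      nonZero : ∀ {l} → M ≡ M′ * l ^ n → l ≢ 0#
      nonZero eq refl = M≢0 (trans eq (trans (cong (M′ *_) (0^ n 1≤n)) (zeroʳ M′)))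

      t′≡lt : t′ ≡ l * t
      t′≡lt with t ≟ 0#
      ... | yes t≡0 = trans t′≡0 (sym (trans (cong (l *_) t≡0) (zeroʳ l)))
        where
        t′≡0 : t′ ≡ 0#
        t′≡0 = x^n≡0⇒x≡0 n (*-cancelˡ M′ M′≢0 (begin
          M′ * t′ ^ n   ≡⟨ eqᵈ ⟨
          M * t ^ n     ≡⟨ cong (λ z → M * z ^ n) t≡0 ⟩
          M * 0# ^ n    ≡⟨ cong (M *_) (0^ n 1≤n) ⟩
          M * 0#        ≡⟨ zeroʳ M ⟩
          0#            ≡⟨ zeroʳ M′ ⟨
          M′ * 0#       ∎))
      -- The second ratio l′ satisfies M = M′ l′ⁿ just as l does, so l and l′ have equal n-th powers
      -- in F_q* and coincide.
      ... | no t≢0 with W-ratio (L∈W x unit′) (L∈W y unit′) t≢0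
      ... | l′ , fix′ , t′≡l′t = trans t′≡l′t (cong (_* t) (sym
        (coprime⇒power-injective n e coprime (fixed⇒x^e≡1 (nonZero eq) fix) (fixed⇒x^e≡1 (nonZero eq′) fix′) (nonZero eq′)
          (*-cancelˡ M′ M′≢0 (trans (sym eq) eq′)))))
        where
        eq : M ≡ M′ * l ^ n
        eq = cancelled s≢0 s′≡ls eqᶜ
        eq′ : M ≡ M′ * l′ ^ n
        eq′ = cancelled t≢0 t′≡l′t eqᵈ

    sufficiency : d₁ ≢ d₂ → Coprime r e → Coprime n e → Injective _≡_ _≡_ f
    sufficiency d₁≢d₂ coprimeʳ coprimeⁿ {x} {y} eq with x ≟ 0# | y ≟ 0#
    ... | yes x≡0 | yes y≡0 = trans x≡0 (sym y≡0)
    ... | yes refl | no y≢0 = contradiction (trans (sym eq) f-0) (f-nonZero d₁≢d₂ y≢0)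
    ... | no x≢0 | yes refl = contradiction (trans eq f-0) (f-nonZero d₁≢d₂ x≢0)
    ... | no x≢0 | no y≢0 = x≡y (proportional (f≡f⇒components≡ d₁≢d₂ x≢0 y≢0 eq))
      where
      Nᵏ≢0 : ∀ {z} → z ≢ 0# → N z ^ k ≢ 0#
      Nᵏ≢0 z≢0 = ^-nonZero k (N-nonZero z≢0)

      proportional : (N x ^ k * L u x ^ n ≡ N y ^ k * L u y ^ n) × (N x ^ k * L v x ^ n ≡ N y ^ k * L v y ^ n) →
                     ∃ λ λ′ → Fixed λ′ × y ≡ λ′ * x
      proportional (eqᵤ , eqᵥ) with L u x ≟ 0# | L v x ≟ 0#
      ... | no s≢0 | _ = components≡⇒proportional unitᵤ unitᵥ u≢v coprimeⁿ (Nᵏ≢0 x≢0) (Nᵏ≢0 y≢0) s≢0 eqᵤ eqᵥ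
      -- The component named first must be nonzero to define the ratio, so u and v exchange roles.
      ... | yes _ | no t≢0 = components≡⇒proportional unitᵥ unitᵤ (u≢v ∘ sym) coprimeⁿ (Nᵏ≢0 x≢0) (Nᵏ≢0 y≢0) t≢0 eqᵥ eqᵤ
      ... | yes s≡0 | yes t≡0 = contradiction (L-injective u≢v (trans s≡0 (sym (L-0 u))) (trans t≡0 (sym (L-0 v)))) x≢0

      x≡y : (∃ λ λ′ → Fixed λ′ × y ≡ λ′ * x) → x ≡ y
      x≡y (l , fix , y≡lx) = sym (trans y≡lx (trans (cong (_* x) l≡1) (*-identityˡ x)))
        where
        l≢0 : l ≢ 0#
        l≢0 refl = y≢0 (trans y≡lx (zeroˡ x))

        l^e≡1 : l ^ e ≡ 1#
        l^e≡1 = fixed⇒x^e≡1 l≢0 fix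

        l≡1 : l ≡ 1#
        l≡1 = coprime⇒trivial r e coprimeʳ l^e≡1 (*-cancelʳ (f x) (f-nonZero d₁≢d₂ x≢0) (begin
          l ^ r * f x   ≡⟨ f-scale x l^e≡1 ⟨
          f (l * x)     ≡⟨ cong f y≡lx ⟨
          f y           ≡⟨ eq ⟨
          f x           ≡⟨ *-identityˡ (f x) ⟨
          1# * f x      ∎))

    -- Necessity

    module _ (inj : Injective _≡_ _≡_ f) where

      -- A nontrivial l in F_q with l^r = 1 would give f(l) = f(1).
      injective⇒gcd[r,e]≡1 : gcd r e ≡ 1
      injective⇒gcd[r,e]≡1 = decidable-stable (gcd r e ℕ.≟ 1) λ gcd≢1 →
        let l , l≢1 , fix , l^r≡1 = gcd≢1⇒nontrivialRoot r gcd≢1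
            l≢0 : l ≢ 0#
            l≢0 l≡0 = 0≢1 (trans (sym (0^ r 1≤r)) (trans (cong (_^ r) (sym l≡0)) l^r≡1))
        in l≢1 (trans (sym (*-identityʳ l)) (inj (begin
          f (l * 1#)     ≡⟨ f-scale 1# (fixed⇒x^e≡1 l≢0 fix) ⟩
          l ^ r * f 1#   ≡⟨ cong (_* f 1#) l^r≡1 ⟩
          1# * f 1#      ≡⟨ *-identityˡ (f 1#) ⟩
          f 1#           ∎)))

      -- If G takes the same value at (Lᵤ x, Lᵥ x) and (Lᵤ y, Lᵥ y), then f(x) = f(μy) for the
      -- element μ ∈ F_q with μʳ = (N(x)/N(y))ᵏ.
      G≡G⇒proportional : ∀ {x y} → x ≢ 0# → y ≢ 0# → G (L u x) (L v x) ≡ G (L u y) (L v y) →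
                         ∃ λ μ′ → Fixed μ′ × x ≡ μ′ * y
      G≡G⇒proportional {x} {y} x≢0 y≢0 eq
        -- W(1) is F_q itself, so the quotient of the two norms is again obtained as a ratio on a
        -- line.
        with W-ratio {1#} (trivialW (N-fixed y)) (trivialW (N-fixed x)) (N-nonZero y≢0)
        where
        trivialW : ∀ {z} → Fixed z → W 1# z
        trivialW fix = trans (*-identityʳ _) fix
      ... | c , fix , Nx≡cNy = root (coprime⇒root r e (gcd≡1⇒coprime injective⇒gcd[r,e]≡1)
                                      (^-nonZero k c≢0) (fixed⇒x^e≡1 (^-nonZero k c≢0) (fixed-^ k fix)))
        where
        c≢0 : c ≢ 0#
        c≢0 refl = N-nonZero x≢0 (trans Nx≡cNy (zeroˡ _))

        root : (∃ λ μ′ → μ′ ^ e ≡ 1# × μ′ ^ r ≡ c ^ k) → ∃ λ μ′ → Fixed μ′ × x ≡ μ′ * y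
        root (l , l^e≡1 , l^r≡c^k) = l , x^e≡1⇒fixed l^e≡1 , inj (begin
          f x                                       ≡⟨ f≡ x≢0 ⟩
          N x ^ k * G (L u x) (L v x)               ≡⟨ cong₂ (λ z w → z ^ k * w) Nx≡cNy eq ⟩
          (c * N y) ^ k * G (L u y) (L v y)         ≡⟨ cong (_* G (L u y) (L v y)) (^-distrib-* c (N y) k) ⟩
          c ^ k * N y ^ k * G (L u y) (L v y)       ≡⟨ *-assoc _ _ _ ⟩
          c ^ k * (N y ^ k * G (L u y) (L v y))     ≡⟨ cong₂ _*_ l^r≡c^k (f≡ y≢0) ⟨
          l ^ r * f y                               ≡⟨ f-scale y l^e≡1 ⟨
          f (l * y)                                 ∎)

      -- For l in F_q with lⁿ = 1, `G` agrees at (s, t) and (l s, t), so the corresponding x and y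
      -- are proportional. The untouched coordinate t forces the factor to be 1, and the other
      -- coordinate then gives l = 1.
      injective⇒gcd[n,e]≡1 : gcd n e ≡ 1
      injective⇒gcd[n,e]≡1 = decidable-stable (gcd n e ℕ.≟ 1) λ gcd≢1 →
        let l , l≢1 , fix , l^n≡1 = gcd≢1⇒nontrivialRoot n gcd≢1
            s , s≢0 , Ws = W-nontrivial unitᵤ
            t , t≢0 , Wt = W-nontrivial unitᵥ
            x , Lᵤx≡s , Lᵥx≡t = L-interpolate unitᵤ unitᵥ u≢v Ws Wt
            y , Lᵤy≡ls , Lᵥy≡t = L-interpolate unitᵤ unitᵥ u≢v (W-scale fix Ws) Wt
            nonZero : ∀ {z} → L v z ≡ t → z ≢ 0#
            nonZero Lᵥz≡t z≡0 = t≢0 (trans (sym Lᵥz≡t) (trans (cong (L v) z≡0) (L-0 v)))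
            G≡G : G (L u x) (L v x) ≡ G (L u y) (L v y)
            G≡G = begin
              G (L u x) (L v x)   ≡⟨ cong₂ G Lᵤx≡s Lᵥx≡t ⟩
              G s t               ≡⟨ cong (λ z → a * z + b * t ^ n) (trans (^-distrib-* l s n) (trans (cong (_* s ^ n) l^n≡1) (*-identityˡ _))) ⟨
              G (l * s) t         ≡⟨ cong₂ G Lᵤy≡ls Lᵥy≡t ⟨
              G (L u y) (L v y)   ∎
            m′ , m-fix , x≡my = G≡G⇒proportional (nonZero Lᵥx≡t) (nonZero Lᵥy≡t) G≡G
            m≡1 : m′ ≡ 1#
            m≡1 = *-cancelʳ t t≢0 (begin
              m′ * t         ≡⟨ cong (m′ *_) Lᵥy≡t ⟨
              m′ * L v y     ≡⟨ L-scale v y m-fix ⟨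
              L v (m′ * y)   ≡⟨ cong (L v) x≡my ⟨
              L v x          ≡⟨ Lᵥx≡t ⟩
              t              ≡⟨ *-identityˡ t ⟨
              1# * t         ∎)
        in l≢1 (*-cancelʳ s s≢0 (begin
          l * s          ≡⟨ Lᵤy≡ls ⟨
          L u y          ≡⟨ cong (L u) (trans x≡my (trans (cong (_* y) m≡1) (*-identityˡ y))) ⟨
          L u x          ≡⟨ Lᵤx≡s ⟩
          s              ≡⟨ *-identityˡ s ⟨
          1# * s         ∎))

      -- If d₁ = d₂, then −aS / (bT) lies in F_q for S ∈ W(uⁿ), T ∈ W(vⁿ), so an n-th root of it
      -- yields a nonzero root of f.
      injective⇒d₁≢d₂ : d₁ ≢ d₂
      injective⇒d₁≢d₂ d₁≡d₂ =
        let s , s≢0 , Ws = W-nontrivial unitᵤ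
            t , t≢0 , Wt = W-nontrivial unitᵥ
            S = s ^ n
            T = t ^ n
            bT≢0 = *-nonZero b≢0 (^-nonZero n t≢0)
            c = (- (a * S)) / (b * T)
            relation : c * (b * T) + a * S ≡ 0#
            relation = begin
              c * (b * T) + a * S   ≡⟨ cong (_+ a * S) (trans (*-assoc (- (a * S)) _ _) (trans (cong (- (a * S) *_) (inverseˡ (b * T) bT≢0)) (*-identityʳ _))) ⟩
              - (a * S) + a * S     ≡⟨ trans (+-comm _ _) (-‿inverseʳ (a * S)) ⟩
              0#                    ∎
            c≢0 : c ≢ 0#
            c≢0 c≡0 = *-nonZero a≢0 (^-nonZero n s≢0) (begin
              a * S                    ≡⟨ +-identityˡ _ ⟨
              0# + a * S               ≡⟨ cong (_+ a * S) (trans (cong (_* (b * T)) c≡0) (zeroˡ _)) ⟨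
              c * (b * T) + a * S      ≡⟨ relation ⟩
              0#                       ∎)
            l , l^e≡1 , l^n≡c = coprime⇒root n e (gcd≡1⇒coprime injective⇒gcd[n,e]≡1) c≢0
              (fixed⇒x^e≡1 c≢0 (c-fixed (W-^ n Ws) (W-^ n Wt) bT≢0 relation))
            x , Lᵤx≡s , Lᵥx≡lt = L-interpolate unitᵤ unitᵥ u≢v Ws (W-scale (x^e≡1⇒fixed l^e≡1) Wt)
            x≢0 : x ≢ 0#
            x≢0 x≡0 = s≢0 (trans (sym Lᵤx≡s) (trans (cong (L u) x≡0) (L-0 u)))
            G≡0 : G (L u x) (L v x) ≡ 0#
            G≡0 = begin
              G (L u x) (L v x)        ≡⟨ cong₂ G Lᵤx≡s Lᵥx≡lt ⟩
              a * S + b * (l * t) ^ n  ≡⟨ cong (λ z → a * S + b * z) (trans (^-distrib-* l t n) (cong (_* T) l^n≡c)) ⟩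
              a * S + b * (c * T)      ≡⟨ solve 4 (λ x b c T → x :+ b :* (c :* T) := c :* (b :* T) :+ x) refl (a * S) b c T ⟩
              c * (b * T) + a * S      ≡⟨ relation ⟩
              0#                       ∎
        in x≢0 (inj (trans (f≡ x≢0) (trans (trans (cong (N x ^ k *_) G≡0) (zeroʳ _)) (sym f-0))))
        where
        -- The conjugate of `relation`, multiplied by a b uⁿ vⁿ, reads φ(c) d₁ bT + d₂ aS = 0. As d₁
        -- = d₂, both φ(c) and c solve one linear equation with nonzero coefficient d₂ bT.
        c-fixed : ∀ {c S T} → W (u ^ n) S → W (v ^ n) T → b * T ≢ 0# → c * (b * T) + a * S ≡ 0# → Fixed c
        c-fixed {c} {S} {T} WS WT bT≢0 relation = *-cancelʳ (d₂ * (b * T)) (*-nonZero d₂≢0 bT≢0)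
          (+-cancelʳ (d₂ * (a * S)) _ _ (begin
            φ c * (d₂ * (b * T)) + d₂ * (a * S)
              ≡⟨ cong (λ d → φ c * (d * (b * T)) + d₂ * (a * S)) d₁≡d₂ ⟨
            φ c * (φ b * a * U * (b * T)) + φ a * b * V * (a * S)
              ≡⟨ cong₂ (λ x y → φ c * (φ b * a * U * (b * x)) + φ a * b * V * (a * y)) WT WS ⟨
            φ c * (φ b * a * U * (b * (φ T * V))) + φ a * b * V * (a * (φ S * U))
              ≡⟨ solve 9 (λ a b c a′ b′ U V S T →
                   c :* (b′ :* a :* U :* (b :* (T :* V))) :+ a′ :* b :* V :* (a :* (S :* U))
                   := (c :* (b′ :* T) :+ a′ :* S) :* (a :* b :* U :* V))
                   refl a b (φ c) (φ a) (φ b) U V (φ S) (φ T) ⟩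
            (φ c * (φ b * φ T) + φ a * φ S) * (a * b * U * V)   ≡⟨ cong (_* (a * b * U * V)) φ-relation ⟩
            0# * (a * b * U * V)                                ≡⟨ trans (zeroˡ _) (sym (zeroʳ d₂)) ⟩
            d₂ * 0#                                             ≡⟨ cong (d₂ *_) relation ⟨
            d₂ * (c * (b * T) + a * S)
              ≡⟨ solve 4 (λ d c y x → d :* (c :* y :+ x) := c :* (d :* y) :+ d :* x) refl d₂ c (b * T) (a * S) ⟩
            c * (d₂ * (b * T)) + d₂ * (a * S)                   ∎))
          where
          U = u ^ n
          V = v ^ n
          d₂≢0 : d₂ ≢ 0#
          d₂≢0 = *-nonZero (*-nonZero (^-nonZero q a≢0) b≢0) (^-nonZero n v≢0)
          φ-relation : φ c * (φ b * φ T) + φ a * φ S ≡ 0#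
          φ-relation = begin
            φ c * (φ b * φ T) + φ a * φ S    ≡⟨ cong₂ (λ x y → φ c * x + y) (φ-* b T) (φ-* a S) ⟨
            φ c * φ (b * T) + φ (a * S)      ≡⟨ cong (_+ φ (a * S)) (φ-* c (b * T)) ⟨
            φ (c * (b * T)) + φ (a * S)      ≡⟨ φ-+ _ _ ⟨
            φ (c * (b * T) + a * S)          ≡⟨ cong φ relation ⟩
            φ 0#                             ≡⟨ φ-0 ⟩
            0#                               ∎

-- Assembling the equivalence

primePower⇒>1 : ∀ {q} → IsPrimePower q → 1 < q
primePower⇒>1 (p , suc k , pr , _ , refl) = ℕ.≤-trans (nonTrivial⇒n>1 p {{prime⇒nonTrivial pr}})
  (ℕ.≤-trans (ℕ.≤-reflexive (sym (ℕ.*-identityʳ p))) (ℕ.*-monoʳ-≤ p (ℕ.m^n>0 p {{prime⇒nonZero pr}} k)))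

theorem1p1 : (q : ℕ) → IsPrimePower q → (F : FiniteField (q ^ℕ 2)) →
    let open FiniteField F in
    (r n : ℕ) → 1 ≤ r → 1 ≤ n → r % suc q ≡ n % suc q →
    (u v : Carrier) → μ (q +ℕ 1) u → μ (q +ℕ 1) v → u ≢ v →
    (a b : Carrier) → a ≢ 0# → b ≢ 0# →
    let B : Carrier → Carrier
        B X = a * (X + u) ^ n + b * (X + v) ^ n
        f : Carrier → Carrier
        f X = X ^ r * B (X ^ (q ∸ 1))
    in Bijective _≡_ _≡_ f ⇔ (((b / a) ^ (q ∸ 1) ≢ (v / u) ^ n) × gcd (r *ℕ n) (q ∸ 1) ≡ 1)
theorem1p1 zero isPrimePower = contradiction (primePower⇒>1 {zero} isPrimePower) λ ()
theorem1p1 (suc e) isPrimePower F r n 1≤r 1≤n r≡n u v u∈μ v∈μ u≢v a b a≢0 b≢0 =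
  mk⇔ (λ (inj , _) → injective⇒d₁≢d₂ inj ∘ ratio≡⇒d₁≡d₂
                   , gcd≡1⇒gcd-*≡1 r n e (injective⇒gcd[r,e]≡1 inj) (injective⇒gcd[n,e]≡1 inj))
      (λ (ratio≢ , gcd≡1) → injective⇒bijective
        (sufficiency (ratio≢ ∘ d₁≡d₂⇒ratio≡)
          (gcd≡1⇒coprime (gcd-*≡1⇒gcd≡1ˡ r n e gcd≡1)) (gcd≡1⇒coprime (gcd-*≡1⇒gcd≡1ʳ r n e gcd≡1))))
  where
  1≤e : 1 ≤ e
  1≤e = ℕ.≤-pred (primePower⇒>1 {suc e} isPrimePower)
  open QuadraticExtension e 1≤e isPrimePower F
  unit : ∀ {c} → c ^ (suc e +ℕ 1) ≡ 1# → φ c * c ≡ 1#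
  unit {c} c∈μ = trans (cong (φ c *_) (sym (*-identityʳ c))) (trans (sym (^-homo-* c q 1)) c∈μ)
  open PermutationCriterion r n 1≤r 1≤n r≡n u v (unit u∈μ) (unit v∈μ) u≢v a b a≢0 b≢0
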